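{- Let $e$ be a graphic sequence in $\mathcal{P}_{s,n}$ such that $e$ has at least one forced pair. Then there is a sequence $d\in\mathcal{P}_{s,n}$ that is split or canonically decomposable and that can be obtained from $e$ by at most three elementary transformations (i.e., $d$ lies at most three covering steps above $e$ in $\mathcal{P}_{s,n}$).
   Context: $\mathcal{P}_{s,n}$ is the set of nonincreasing lists of $n$ nonnegative integers with sum $s$, ordered by dominance: $a\succeq b$ if the sums agree and $\sum_{i=1}^j a_i\ge\sum_{i=1}^j b_i$ for all $j$. An elementary transformation changes a sequence into one that covers it in $\mathcal{P}_{s,n}$ (equivalently, increases some term by 1 and decreases a later term by 1, keeping the order nonincreasing, such that the result covers the original). A list is graphic if it is the degree sequence of a finite simple graph. Realizations of $e=(e_1,\dots,e_n)$ are labeled graphs on $[n]$ in which vertex $\ell$ has degree $e_\ell$; a forced pair is a pair $\{i,j\}$ adjacent in every realization or in no realization. A split graph is one whose vertex set partitions into an independent set and a clique; a sequence is split if it has a split realization. For a split graph $F$ with partition $A$ (independent), $B$ (clique) and a graph $H$, $(F,A,B)\circ H$ is obtained from $F+H$ by adding all edges between $B$ and $V(H)$; a graph is canonically decomposable if it equals $(F,A,B)\circ H$ for nonempty induced subgraphs $F,H$ and such a partition of $V(F)$, and a sequence is canonically decomposable if it has a canonically decomposable realization. -}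

module Defs where

open import Data.Nat using (ℕ; zero; suc; _+_; _≤_)
open import Data.Fin using (Fin)
import Data.Fin as F
open import Data.Vec using (Vec; []; _∷_; lookup; allFin; map; sum)
open import Data.Bool using (Bool; true; false; if_then_else_)
open import Data.Product using (Σ; ∃; _×_; _,_)
open import Data.Sum using (_⊎_)
open import Relation.Binary.PropositionalEquality using (_≡_; _≢_)

prefix : ∀ {n} → ℕ → Vec ℕ n → ℕ
prefix zero    _        = 0
prefix (suc j) []       = 0
prefix (suc j) (x ∷ xs) = x + prefix j xs

Nonincreasing : ∀ {n} → Vec ℕ n → Set
Nonincreasing {n} a = ∀ (i j : Fin n) → i F.≤ j → lookup a j ≤ lookup a i

InP : ℕ → (n : ℕ) → Vec ℕ n → Set
InP s n a = Nonincreasing a × sum a ≡ s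

_⊵_ : ∀ {n} → Vec ℕ n → Vec ℕ n → Set
a ⊵ b = (sum a ≡ sum b) × (∀ j → prefix j b ≤ prefix j a)

-- b covers a in P_{s,n}  (b is obtained from a by an elementary transformation)
Covers : ℕ → (n : ℕ) → Vec ℕ n → Vec ℕ n → Set
Covers s n a b =
  InP s n b × (b ⊵ a) × (a ≢ b) ×
  (∀ (c : Vec ℕ n) → InP s n c → c ⊵ a → b ⊵ c → (c ≡ a) ⊎ (c ≡ b))

Steps : ℕ → (n : ℕ) → ℕ → Vec ℕ n → Vec ℕ n → Set
Steps s n zero    e d = e ≡ d
Steps s n (suc k) e d = Σ (Vec ℕ n) λ c → Covers s n e c × Steps s n k c d

record Graph (n : ℕ) : Set where
  field
    adj   : Fin n → Fin n → Bool
    sym   : ∀ i j → adj i j ≡ adj j i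
    irrefl : ∀ i → adj i i ≡ false
open Graph public

degree : ∀ {n} → Graph n → Fin n → ℕ
degree {n} G i = sum (map (λ j → if adj G i j then 1 else 0) (allFin n))

Realizes : ∀ {n} → Graph n → Vec ℕ n → Set
Realizes {n} G e = ∀ (ℓ : Fin n) → degree G ℓ ≡ lookup e ℓ

Graphic : ∀ {n} → Vec ℕ n → Set
Graphic {n} e = Σ (Graph n) λ G → Realizes G e

ForcedPair : ∀ {n} → Vec ℕ n → Fin n → Fin n → Set
ForcedPair {n} e i j =
  (i ≢ j) ×
  ((∀ (G : Graph n) → Realizes G e → adj G i j ≡ true) ⊎
   (∀ (G : Graph n) → Realizes G e → adj G i j ≡ false))

HasForcedPair : ∀ {n} → Vec ℕ n → Set
HasForcedPair {n} e = Σ (Fin n) λ i → Σ (Fin n) λ j → ForcedPair e i j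

IsSplitGraph : ∀ {n} → Graph n → Set
IsSplitGraph {n} G = Σ (Fin n → Bool) λ inB →
  (∀ u v → inB u ≡ false → inB v ≡ false → adj G u v ≡ false) ×
  (∀ u v → inB u ≡ true → inB v ≡ true → u ≢ v → adj G u v ≡ true)

data Role : Set where
  roleA roleB roleH : Role

-- G = (F,A,B) ∘ H with V(F) = A ∪ B and V(H) both nonempty, A independent,
-- B a clique, all edges between B and V(H), no edges between A and V(H)
IsCanDecGraph : ∀ {n} → Graph n → Set
IsCanDecGraph {n} G = Σ (Fin n → Role) λ r →
  (Σ (Fin n) λ v → (r v ≡ roleA) ⊎ (r v ≡ roleB)) ×
  (Σ (Fin n) λ v → r v ≡ roleH) ×
  (∀ u v → r u ≡ roleA → r v ≡ roleA → adj G u v ≡ false) ×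
  (∀ u v → r u ≡ roleB → r v ≡ roleB → u ≢ v → adj G u v ≡ true) ×
  (∀ u v → r u ≡ roleB → r v ≡ roleH → adj G u v ≡ true) ×
  (∀ u v → r u ≡ roleA → r v ≡ roleH → adj G u v ≡ false)

SplitSeq : ∀ {n} → Vec ℕ n → Set
SplitSeq {n} d = Σ (Graph n) λ G → Realizes G d × IsSplitGraph G

CanDecSeq : ∀ {n} → Vec ℕ n → Set
CanDecSeq {n} d = Σ (Graph n) λ G → Realizes G d × IsCanDecGraph G

{-# OPTIONS --safe #-}

-- If a pair is forced to be an edge, then so is the pair of the two largest degrees, and adding 1 to
-- both of them leaves a sequence that is not graphic; if a pair is forced to be a non-edge, subtract 1
-- from the two smallest degrees instead (a degree 0 already gives a canonical decomposition).  Either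
-- way the Erdős–Gallai criterion yields a set B of the r largest degrees, r ≥ 1, for which the
-- inequality of e has slack at most 1.  In a realization of e, slack 0 means that the clique B, the
-- vertices of degree < r and the remaining vertices form a canonical decomposition or a split
-- partition.  Slack 1 means that exactly one pair violates this structure, and moving one end of an
-- edge from a vertex y outside B to a vertex b of B removes the violation.  Inside the structure b and
-- y can be traded for the first index i with e_i = e_r and the last index j with e_j = e_{r+1}, and
-- e + 1_i − 1_j is reached from e by at most three covers.

module Submission where

open import Defs
open import Data.Bool as Bool using (Bool; true; false; if_then_else_; _∧_)
open import Data.Bool.Properties using (¬-not)
open import Data.Fin using (Fin; zero; suc; toℕ; fromℕ; fromℕ<; inject₁)
open import Data.Fin.Properties
  using (_≟_; any?; toℕ-injective; toℕ<n; toℕ-fromℕ; toℕ-fromℕ<; toℕ-inject₁)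
open import Data.Nat as ℕ using (ℕ; zero; suc; _+_; _⊓_; _∸_; _≤_; _<_; _≤?_; z≤n; s≤s)
open import Data.Nat.Properties as ℕₚ using ()
open import Data.Nat.Solver using (module +-*-Solver)
open import Data.Product using (Σ; ∃; _×_; _,_; proj₁; proj₂)
open import Data.Sum using (_⊎_; inj₁; inj₂)
open import Data.Vec as Vec using (Vec; []; _∷_; lookup)
open import Data.Vec.Properties using (tabulate-allFin)
open import Function using (_∘_)
open import Relation.Binary.Definitions using (tri<; tri≈; tri>)
open import Relation.Binary.PropositionalEquality
  using (_≡_; _≢_; refl; trans; cong; cong₂; subst; subst₂; module ≡-Reasoning)
  renaming (sym to ≡-sym)
open import Relation.Nullary using (¬_; Dec; yes; no; does; contradiction; ¬?; _×-dec_; _⊎-dec_)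
open import Relation.Nullary.Decidable using (dec-true; dec-false)
open import Algebra.Properties.CommutativeMonoid.Sum ℕₚ.+-0-commutativeMonoid
  using (sum; sum-cong-≗; ∑-distrib-+; ∑-comm; sum-replicate-zero)

open +-*-Solver using (solve; _:=_; _:+_; con)

-- Sums of natural numbers

-- Two degrees are changed at once because this keeps the sum even: then only a violated inequality
-- can stop the new sequence from being graphic. Such a violation is strict and the change shifts
-- the comparison by at most 2, which leaves slack at most 1 for `e`. The obstacle lies in the case
-- of slack 1. The repair realizes e + 1_b - 1_y for a `b` and a `y` that cannot be chosen; this
-- sequence need not be nonincreasing, and it may lie many covers above `e`. What rescues the
-- argument is that two vertices with the same role have the same prescribed adjacencies, so a
-- surplus or a loss of one edge end can be handed from one to the other without leaving the
-- structure. Plateau ends are the right recipients, since raising the first entry of a plateau and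
-- lowering the last entry of another keeps the order. The number three counts what the unit has to
-- cross on its way from `j` to `i`: the plateau of r + 1, the drop from `r` to r + 1, and the
-- plateau of `r`, each in one cover.

sum-mono : ∀ {n} {f g : Fin n → ℕ} → (∀ i → f i ≤ g i) → sum f ≤ sum g
sum-mono {zero}  f≤g = z≤n
sum-mono {suc n} f≤g = ℕₚ.+-mono-≤ (f≤g zero) (sum-mono (f≤g ∘ suc))

sum-mono-< : ∀ {n} {f g : Fin n → ℕ} → (∀ i → f i ≤ g i) →
             ∀ j → f j < g j → sum f < sum g
sum-mono-< f≤g zero    lt = ℕₚ.+-mono-<-≤ lt (sum-mono (f≤g ∘ suc))
sum-mono-< f≤g (suc j) lt = ℕₚ.+-mono-≤-< (f≤g zero) (sum-mono-< (f≤g ∘ suc) j lt)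

sum-mono-≡ : ∀ {n} {f g : Fin n → ℕ} → (∀ i → f i ≤ g i) → sum g ≤ sum f →
             ∀ i → f i ≡ g i
sum-mono-≡ f≤g Σg≤Σf i with ℕₚ.m≤n⇒m<n∨m≡n (f≤g i)
... | inj₂ eq = eq
... | inj₁ lt = contradiction (sum-mono-< f≤g i lt) (ℕₚ.≤⇒≯ Σg≤Σf)

sum-<⇒∃< : ∀ {n} {f g : Fin n → ℕ} → sum f < sum g → ∃ λ i → f i < g i
sum-<⇒∃< {f = f} {g} lt with any? (λ i → f i ℕ.<? g i)
... | yes found = found
... | no none = contradiction lt
      (ℕₚ.≤⇒≯ (sum-mono λ i → ℕₚ.≮⇒≥ λ fi<gi → none (i , fi<gi)))

-- Defined on ℕ so that vertices (through `δF`) and positions of a sequence (in `Transfer`) share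
-- the same unit vectors.
δ : ℕ → ℕ → ℕ
δ zero    zero    = 1
δ zero    (suc _) = 0
δ (suc _) zero    = 0
δ (suc i) (suc j) = δ i j

δ-refl : ∀ i → δ i i ≡ 1
δ-refl zero    = refl
δ-refl (suc i) = δ-refl i

δ-≢ : ∀ {i j} → i ≢ j → δ i j ≡ 0
δ-≢ {zero}  {zero}  i≢j = contradiction refl i≢j
δ-≢ {zero}  {suc _} i≢j = refl
δ-≢ {suc _} {zero}  i≢j = refl
δ-≢ {suc i} {suc j} i≢j = δ-≢ (i≢j ∘ cong suc)

δF : ∀ {n} → Fin n → Fin n → ℕ
δF i j = δ (toℕ i) (toℕ j)

δF-≢ : ∀ {n} {i j : Fin n} → i ≢ j → δF i j ≡ 0
δF-≢ i≢j = δ-≢ (i≢j ∘ toℕ-injective)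

sum-δF : ∀ {n} (i : Fin n) → sum (δF i) ≡ 1
sum-δF {suc n} zero    = cong suc (sum-replicate-zero n)
sum-δF         (suc i) = sum-δF i

sum-+δF : ∀ {n} (f : Fin n → ℕ) i → sum (λ j → f j + δF i j) ≡ suc (sum f)
sum-+δF f i = trans (∑-distrib-+ f (δF i))
  (trans (cong (sum f +_) (sum-δF i)) (ℕₚ.+-comm (sum f) 1))

-- Turns slack at most 1 in an Erdős-Gallai inequality into a pointwise statement: at most one
-- vertex misses its cap, and by exactly 1. Once a strict place `j` is found, `f` plus the unit
-- vector at `j` is still below `g` and has at least the same sum.
sum-≤-suc : ∀ {n} {f g : Fin n → ℕ} → (∀ i → f i ≤ g i) → sum g ≤ suc (sum f) →
            (∀ i → f i ≡ g i) ⊎ ∃ λ j → suc (f j) ≡ g j × (∀ i → i ≢ j → f i ≡ g i)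
sum-≤-suc {f = f} {g} f≤g Σg≤ with any? (λ i → f i ℕ.<? g i)
... | no none = inj₁ λ i → ℕₚ.≤-antisym (f≤g i) (ℕₚ.≮⇒≥ λ lt → none (i , lt))
... | yes (j , fj<gj) = inj₂ (j , at-j , away)
  where
  f⁺≤g : ∀ i → f i + δF j i ≤ g i
  f⁺≤g i with j ≟ i
  ... | yes refl rewrite δ-refl (toℕ j) = subst (_≤ g j) (ℕₚ.+-comm 1 (f j)) fj<gj
  ... | no j≢i rewrite δF-≢ j≢i = subst (_≤ g i) (≡-sym (ℕₚ.+-identityʳ (f i))) (f≤g i)
  f⁺≡g : ∀ i → f i + δF j i ≡ g i
  f⁺≡g = sum-mono-≡ f⁺≤g (subst (sum g ≤_) (≡-sym (sum-+δF f j)) Σg≤)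
  at-j : suc (f j) ≡ g j
  at-j = trans (≡-sym (trans (cong (f j +_) (δ-refl (toℕ j))) (ℕₚ.+-comm (f j) 1))) (f⁺≡g j)
  away : ∀ i → i ≢ j → f i ≡ g i
  away i i≢j = trans (≡-sym (trans (cong (f i +_) (δF-≢ (i≢j ∘ ≡-sym))) (ℕₚ.+-identityʳ (f i)))) (f⁺≡g i)

-- The handshake lemma: row 0 and column 0 are equal and contribute the same amount twice.
sum-symmetric-even : ∀ {n} (a : Fin n → Fin n → ℕ) → (∀ i j → a i j ≡ a j i) →
  (∀ i → a i i ≡ 0) → ∃ λ t → sum (λ i → sum (a i)) ≡ t + t
sum-symmetric-even {zero}  a a-sym a-diag = 0 , refl
sum-symmetric-even {suc n} a a-sym a-diag
  with sum-symmetric-even (λ i j → a (suc i) (suc j)) (λ i j → a-sym (suc i) (suc j)) (a-diag ∘ suc)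
... | t , eq = row + t , (begin
  (a zero zero + row) + sum (λ i → a (suc i) zero + sum (λ j → a (suc i) (suc j)))
    ≡⟨ cong₂ _+_ (cong (_+ row) (a-diag zero)) (∑-distrib-+ (λ i → a (suc i) zero) _) ⟩
  row + (sum (λ i → a (suc i) zero) + sum (λ i → sum (λ j → a (suc i) (suc j))))
    ≡⟨ cong (row +_) (cong₂ _+_ (sum-cong-≗ λ i → a-sym (suc i) zero) eq) ⟩
  row + (row + (t + t))
    ≡⟨ solve 2 (λ r s → r :+ (r :+ (s :+ s)) := (r :+ s) :+ (r :+ s)) refl row t ⟩
  (row + t) + (row + t) ∎)
  where
  open ≡-Reasoning
  row = sum (λ j → a zero (suc j))

𝟙 : Bool → ℕ
𝟙 b = if b then 1 else 0

𝟙≤1 : ∀ b → 𝟙 b ≤ 1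
𝟙≤1 false = z≤n
𝟙≤1 true  = s≤s z≤n

𝟙-< : ∀ {b c} → 𝟙 b < 𝟙 c → b ≡ false × c ≡ true
𝟙-< {false} {true} _ = refl , refl
𝟙-< {true}  {true} (s≤s ())
𝟙-< {false} {false} ()
𝟙-< {true} {false} ()

true≢false : ∀ {b} → b ≡ true → b ≡ false → ∀ {A : Set} → A
true≢false refl ()

-- Degrees and edge surgery

deg : ∀ {n} → Graph n → Fin n → ℕ
deg G i = sum (λ j → 𝟙 (adj G i j))

Vec-sum-tabulate : ∀ {n} (f : Fin n → ℕ) → Vec.sum (Vec.tabulate f) ≡ sum f
Vec-sum-tabulate {zero}  f = refl
Vec-sum-tabulate {suc n} f = cong (f zero +_) (Vec-sum-tabulate (f ∘ suc))

degree≡deg : ∀ {n} (G : Graph n) i → degree G i ≡ deg G i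
degree≡deg G i =
  trans (cong Vec.sum (≡-sym (tabulate-allFin row))) (Vec-sum-tabulate row)
  where row = λ j → 𝟙 (adj G i j)

deg-sum-even : ∀ {n} (G : Graph n) → ∃ λ t → sum (deg G) ≡ t + t
deg-sum-even G = sum-symmetric-even (λ i j → 𝟙 (adj G i j))
  (λ i j → cong 𝟙 (Graph.sym G i j)) (λ i → cong 𝟙 (irrefl G i))

adj⇒≢ : ∀ {n} (G : Graph n) {x y} → adj G x y ≡ true → x ≢ y
adj⇒≢ G {x} xy refl = true≢false xy (irrefl G x)

adj-sym : ∀ {n} (G : Graph n) {x y b} → adj G x y ≡ b → adj G y x ≡ b
adj-sym G {x} {y} eq = trans (Graph.sym G y x) eq

Pair : ∀ {n} → Fin n → Fin n → Fin n → Fin n → Set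
Pair x y u v = (u ≡ x × v ≡ y) ⊎ (u ≡ y × v ≡ x)

-- Opaque, so that splitting on `l ≟ x` in `row-eq` does not unfold the adjacency of the new graph.
abstract
  pair? : ∀ {n} (x y u v : Fin n) → Dec (Pair x y u v)
  pair? x y u v = (u ≟ x ×-dec v ≟ y) ⊎-dec (u ≟ y ×-dec v ≟ x)

Pair-swap : ∀ {n} {x y u v : Fin n} → Pair x y u v → Pair x y v u
Pair-swap (inj₁ (p , q)) = inj₂ (q , p)
Pair-swap (inj₂ (p , q)) = inj₁ (q , p)

module _ {n} (G : Graph n) {x y : Fin n} (x≢y : x ≢ y) (β : Bool) where

  private
    new : Fin n → Fin n → Bool
    new u v = if does (pair? x y u v) then β else adj G u v

    new-on : ∀ {u v} → Pair x y u v → new u v ≡ β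
    new-on {u} {v} p with pair? x y u v
    ... | yes _ = refl
    ... | no ¬p = contradiction p ¬p

    new-off : ∀ {u v} → ¬ Pair x y u v → new u v ≡ adj G u v
    new-off {u} {v} ¬p with pair? x y u v
    ... | yes p = contradiction p ¬p
    ... | no _  = refl

    new-sym : ∀ u v → new u v ≡ new v u
    new-sym u v with pair? x y u v
    ... | yes p = ≡-sym (new-on (Pair-swap p))
    ... | no ¬p = trans (Graph.sym G u v) (≡-sym (new-off (¬p ∘ Pair-swap)))

    new-irrefl : ∀ u → new u u ≡ false
    new-irrefl u with pair? x y u u
    ... | yes (inj₁ (p , q)) = contradiction (trans (≡-sym p) q) x≢y
    ... | yes (inj₂ (p , q)) = contradiction (trans (≡-sym q) p) x≢y
    ... | no _ = irrefl G u

  setEdge : Graph n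
  setEdge = record { adj = new ; sym = new-sym ; irrefl = new-irrefl }

  setEdge-on : ∀ {u v} → Pair x y u v → adj setEdge u v ≡ β
  setEdge-on = new-on

  setEdge-off : ∀ {u v} → ¬ Pair x y u v → adj setEdge u v ≡ adj G u v
  setEdge-off = new-off

  private
    if-0 : ∀ b → (if b then 0 else 0) ≡ 0
    if-0 true  = refl
    if-0 false = refl

    -- The part of row l of the adjacency matrix due to the pair {x,y} when its entry is b.
    row : Fin n → Bool → Fin n → ℕ
    row l b m = (if does (l ≟ x) then (if b then δF y m else 0) else 0)
              + (if does (l ≟ y) then (if b then δF x m else 0) else 0)

    row-eq : ∀ l m → 𝟙 (adj setEdge l m) + row l (adj G x y) m ≡ 𝟙 (adj G l m) + row l β m
    row-eq l m with l ≟ x | l ≟ y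
    ... | yes refl | yes p = contradiction p x≢y
    ... | no l≢x | no l≢y =
      cong (λ b → 𝟙 b + 0) (setEdge-off λ { (inj₁ (p , _)) → l≢x p ; (inj₂ (p , _)) → l≢y p })
    ... | yes refl | no _ with y ≟ m
    ...   | yes refl rewrite setEdge-on (inj₁ (refl , refl)) | δ-refl (toℕ y) =
      solve 2 (λ a b → a :+ (b :+ con 0) := b :+ (a :+ con 0)) refl (𝟙 β) (𝟙 (adj G x y))
    ...   | no y≢m
      rewrite δF-≢ y≢m | setEdge-off {l} {m} (λ { (inj₁ (_ , q)) → y≢m (≡-sym q) ; (inj₂ (q , _)) → x≢y q })
      = cong (λ k → 𝟙 (adj G l m) + (k + 0)) (trans (if-0 (adj G x y)) (≡-sym (if-0 β)))
    row-eq l m | no _ | yes refl with x ≟ m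
    ...   | yes refl rewrite setEdge-on (inj₂ (refl , refl)) | δ-refl (toℕ x) | Graph.sym G y x = ℕₚ.+-comm (𝟙 β) _
    ...   | no x≢m
      rewrite δF-≢ x≢m | setEdge-off {l} {m} (λ { (inj₁ (q , _)) → x≢y (≡-sym q) ; (inj₂ (_ , q)) → x≢m (≡-sym q) })
      = cong (𝟙 (adj G l m) +_) (trans (if-0 (adj G x y)) (≡-sym (if-0 β)))

    half : ∀ (l x y : Fin n) b → sum (λ m → if does (l ≟ x) then (if b then δF y m else 0) else 0)
             ≡ (if b then δF x l else 0)
    half l x y b with l ≟ x | b
    ... | yes refl | true  = trans (sum-δF {n} y) (≡-sym (δ-refl (toℕ l)))
    ... | yes refl | false = sum-replicate-zero n
    ... | no l≢x   | true  = trans (sum-replicate-zero n) (≡-sym (δF-≢ (l≢x ∘ ≡-sym)))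
    ... | no _     | false = sum-replicate-zero n

    row-sum : ∀ l b → sum (row l b) ≡ (if b then δF x l + δF y l else 0)
    row-sum l b = trans (∑-distrib-+ {n} (λ m → if does (l ≟ x) then (if b then δF y m else 0) else 0)
                                         (λ m → if does (l ≟ y) then (if b then δF x m else 0) else 0))
      (trans (cong₂ _+_ (half l x y b) (half l y x b)) (lem b))
      where
      lem : ∀ b → (if b then δF x l else 0) + (if b then δF y l else 0) ≡ (if b then δF x l + δF y l else 0)
      lem true  = refl
      lem false = refl

  -- The old value of the pair is credited on the left and the new one on the right; insertion and
  -- deletion are thus covered by one identity without subtraction in ℕ.
  setEdge-deg : ∀ l → deg setEdge l + (if adj G x y then δF x l + δF y l else 0)
                    ≡ deg G l + (if β then δF x l + δF y l else 0)
  setEdge-deg l = begin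
    deg setEdge l + (if adj G x y then δF x l + δF y l else 0)
      ≡⟨ cong (deg setEdge l +_) (row-sum l (adj G x y)) ⟨
    deg setEdge l + sum (row l (adj G x y))
      ≡⟨ ∑-distrib-+ (λ m → 𝟙 (adj setEdge l m)) _ ⟨
    sum (λ m → 𝟙 (adj setEdge l m) + row l (adj G x y) m)
      ≡⟨ sum-cong-≗ (row-eq l) ⟩
    sum (λ m → 𝟙 (adj G l m) + row l β m)
      ≡⟨ ∑-distrib-+ (λ m → 𝟙 (adj G l m)) _ ⟩
    deg G l + sum (row l β)
      ≡⟨ cong (deg G l +_) (row-sum l β) ⟩
    deg G l + (if β then δF x l + δF y l else 0) ∎
    where open ≡-Reasoning

addEdge-deg : ∀ {n} (G : Graph n) {x y} (x≢y : x ≢ y) → adj G x y ≡ false →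
  ∀ l → deg (setEdge G x≢y true) l ≡ deg G l + δF x l + δF y l
addEdge-deg G {x} {y} x≢y xy l with adj G x y | xy | setEdge-deg G x≢y true l
... | false | _ | eq = trans (≡-sym (ℕₚ.+-identityʳ (deg (setEdge G x≢y true) l))) (trans eq (≡-sym (ℕₚ.+-assoc (deg G l) _ _)))

removeEdge-deg : ∀ {n} (G : Graph n) {x y} (x≢y : x ≢ y) → adj G x y ≡ true →
  ∀ l → deg (setEdge G x≢y false) l + δF x l + δF y l ≡ deg G l
removeEdge-deg G {x} {y} x≢y xy l with adj G x y | xy | setEdge-deg G x≢y false l
... | true | _ | eq = trans (ℕₚ.+-assoc (deg (setEdge G x≢y false) l) (δF x l) _) (trans eq (ℕₚ.+-identityʳ (deg G l)))

-- The edge zx is replaced by zy.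
record Move {n} (G : Graph n) (z x y : Fin n) : Set where
  field
    graph   : Graph n
    deg-eq  : ∀ l → deg graph l + δF x l ≡ deg G l + δF y l
    adj-old : adj graph z x ≡ false
    adj-new : adj graph z y ≡ true
    adj-off : ∀ {u v} → ¬ Pair z x u v → ¬ Pair z y u v → adj graph u v ≡ adj G u v

move : ∀ {n} (G : Graph n) {z x y} → adj G z x ≡ true → adj G z y ≡ false → z ≢ y →
       Move G z x y
move G {z} {x} {y} zx zy z≢y = record
  { graph   = G₂
  ; deg-eq  = λ l → ℕₚ.+-cancelʳ-≡ (δF z l) _ _ (begin
      deg G₂ l + δF x l + δF z l
        ≡⟨ cong (λ d → d + δF x l + δF z l) (addEdge-deg G₁ z≢y zy₁ l) ⟩
      deg G₁ l + δF z l + δF y l + δF x l + δF z l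
        ≡⟨ solve 4 (λ g a b c → g :+ a :+ b :+ c :+ a := (g :+ a :+ c) :+ b :+ a) refl
             (deg G₁ l) (δF z l) (δF y l) (δF x l) ⟩
      deg G₁ l + δF z l + δF x l + δF y l + δF z l
        ≡⟨ cong (λ d → d + δF y l + δF z l) (removeEdge-deg G z≢x zx l) ⟩
      deg G l + δF y l + δF z l ∎)
  ; adj-old = trans (setEdge-off G₁ z≢y true zx∉zy) (setEdge-on G z≢x false (inj₁ (refl , refl)))
  ; adj-new = setEdge-on G₁ z≢y true (inj₁ (refl , refl))
  ; adj-off = λ ¬zx ¬zy → trans (setEdge-off G₁ z≢y true ¬zy) (setEdge-off G z≢x false ¬zx)
  }
  where
  open ≡-Reasoning
  z≢x = adj⇒≢ G zx
  G₁ = setEdge G z≢x false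
  zx∉zy : ¬ Pair z y z x
  zx∉zy (inj₁ (_ , refl)) = true≢false zx zy
  zx∉zy (inj₂ (p , _))    = z≢y p
  zy₁ : adj G₁ z y ≡ false
  zy₁ = trans (setEdge-off G z≢x false λ
    { (inj₁ (_ , refl)) → true≢false zx zy ; (inj₂ (p , _)) → z≢x p }) zy
  G₂ = setEdge G₁ z≢y true

-- The 2-switch on the alternating 4-cycle p, x, y, q. The move at `p` passes a unit of degree from
-- `x` to `q`, and the move at `y` passes it back.
switch : ∀ {n} (G : Graph n) {p x q y} →
  adj G p x ≡ true → adj G q y ≡ true → adj G p q ≡ false → adj G x y ≡ false →
  p ≢ q → x ≢ y →
  Σ (Graph n) λ G′ → (∀ l → deg G′ l ≡ deg G l) × adj G′ p q ≡ true × adj G′ p x ≡ false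
switch G {p} {x} {q} {y} px qy pq xy p≢q x≢y =
  M₂.graph , degs , trans (M₂.adj-off ¬yq-pq ¬yx-pq) M₁.adj-new
                  , trans (M₂.adj-off ¬yq-px ¬yx-px) M₁.adj-old
  where
  module M₁ = Move (move G px pq p≢q)
  p≢x = adj⇒≢ G px
  q≢y = adj⇒≢ G qy
  y≢p : y ≢ p
  y≢p refl = true≢false (adj-sym G qy) pq
  yq₁ : adj M₁.graph y q ≡ true
  yq₁ = trans (M₁.adj-off
    (λ { (inj₁ (e , _)) → y≢p e ; (inj₂ (_ , e)) → p≢q (≡-sym e) })
    (λ { (inj₁ (e , _)) → y≢p e ; (inj₂ (e , _)) → q≢y (≡-sym e) })) (adj-sym G qy)
  yx₁ : adj M₁.graph y x ≡ false
  yx₁ = trans (M₁.adj-off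
    (λ { (inj₁ (e , _)) → y≢p e ; (inj₂ (e , _)) → x≢y (≡-sym e) })
    (λ { (inj₁ (e , _)) → y≢p e ; (inj₂ (e , _)) → q≢y (≡-sym e) })) (adj-sym G xy)
  module M₂ = Move (move M₁.graph yq₁ yx₁ (x≢y ∘ ≡-sym))
  degs : ∀ l → deg M₂.graph l ≡ deg G l
  degs l = ℕₚ.+-cancelʳ-≡ (δF q l) _ _ (trans (M₂.deg-eq l) (M₁.deg-eq l))
  ¬yq-pq : ¬ Pair y q p q
  ¬yq-pq (inj₁ (e , _)) = y≢p (≡-sym e)
  ¬yq-pq (inj₂ (e , _)) = p≢q e
  ¬yx-pq : ¬ Pair y x p q
  ¬yx-pq (inj₁ (e , _)) = y≢p (≡-sym e)
  ¬yx-pq (inj₂ (e , _)) = p≢x e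
  ¬yq-px : ¬ Pair y q p x
  ¬yq-px (inj₁ (e , _)) = y≢p (≡-sym e)
  ¬yq-px (inj₂ (e , _)) = p≢q e
  ¬yx-px : ¬ Pair y x p x
  ¬yx-px (inj₁ (e , _)) = y≢p (≡-sym e)
  ¬yx-px (inj₂ (e , _)) = p≢x e

-- The larger neighbourhood is not contained in the smaller one. The only unwanted witness is `y`
-- itself, which can occur only if `x` and `y` are adjacent.
exchange-< : ∀ {n} (G : Graph n) {x y} → deg G y < deg G x →
  ∃ λ z → adj G z x ≡ true × adj G z y ≡ false × z ≢ y
exchange-< G {x} {y} dy<dx with adj G x y in xy
... | false with sum-<⇒∃< dy<dx
...   | z , lt with 𝟙-< {adj G y z} lt
...     | yz , xz = z , adj-sym G xz , adj-sym G yz , λ { refl → true≢false xz xy }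
exchange-< G {x} {y} dy<dx | true
  -- The two extra terms cancel the contributions of the edge xy to the two degrees.
  with sum-<⇒∃< {f = λ u → 𝟙 (adj G y u) + δF y u} {g = λ u → 𝟙 (adj G x u) + δF x u}
         (subst₂ _<_ (≡-sym (sum-+δF (λ u → 𝟙 (adj G y u)) y))
                     (≡-sym (sum-+δF (λ u → 𝟙 (adj G x u)) x)) (s≤s dy<dx))
... | z , lt with z ≟ x | z ≟ y
...   | yes refl | _ rewrite adj-sym G xy | irrefl G z | δ-refl (toℕ z) = contradiction lt (ℕₚ.≤⇒≯ (ℕₚ.m≤m+n 1 _))
...   | no z≢x | yes refl rewrite xy | irrefl G z | δ-refl (toℕ z) | δF-≢ (z≢x ∘ ≡-sym) = contradiction lt ℕₚ.1+n≰n
...   | no z≢x | no z≢y rewrite δF-≢ (z≢x ∘ ≡-sym) | δF-≢ (z≢y ∘ ≡-sym)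
  with 𝟙-< {adj G y z} (subst₂ _<_ (ℕₚ.+-identityʳ _) (ℕₚ.+-identityʳ _) lt)
...     | yz , xz = z , adj-sym G xz , adj-sym G yz , z≢y

-- Deleting the edge `vy` lowers the degree of `y` but not that of `x`, which makes the comparison
-- strict. The witness is not `v`, as `v` is not adjacent to `x`, so it survives in `G`.
exchange-≤ : ∀ {n} (G : Graph n) {x y v} → deg G y ≤ deg G x →
  adj G v y ≡ true → adj G v x ≡ false → v ≢ x →
  ∃ λ z → adj G z x ≡ true × adj G z y ≡ false × z ≢ y
exchange-≤ G {x} {y} {v} dy≤dx vy vx v≢x with exchange-< G′ d′y<d′x
  where
  v≢y = adj⇒≢ G vy
  y≢x : y ≢ x
  y≢x refl = true≢false vy vx
  G′ = setEdge G v≢y false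
  eqs = removeEdge-deg G v≢y vy
  d′y : suc (deg G′ y) ≡ deg G y
  d′y = trans (≡-sym (trans (cong₂ (λ a b → deg G′ y + a + b) (δF-≢ v≢y) (δ-refl (toℕ y)))
          (trans (cong (_+ 1) (ℕₚ.+-identityʳ (deg G′ y))) (ℕₚ.+-comm (deg G′ y) 1)))) (eqs y)
  d′x : deg G′ x ≡ deg G x
  d′x = trans (≡-sym (trans (cong₂ (λ a b → deg G′ x + a + b) (δF-≢ v≢x) (δF-≢ y≢x))
          (trans (ℕₚ.+-identityʳ _) (ℕₚ.+-identityʳ (deg G′ x))))) (eqs x)
  d′y<d′x : deg G′ y < deg G′ x
  d′y<d′x = subst₂ _≤_ (≡-sym d′y) (≡-sym d′x) dy≤dx
... | z , zx , zy , z≢y = z , zxG , zyG , z≢y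
  where
  y≢x : y ≢ x
  y≢x refl = true≢false vy vx
  v≢y = adj⇒≢ G vy
  z≢v : z ≢ v
  z≢v refl = true≢false zx (trans (setEdge-off G v≢y false
    λ { (inj₁ (_ , e)) → y≢x (≡-sym e) ; (inj₂ (e , _)) → v≢y e }) vx)
  zxG : adj G z x ≡ true
  zxG = trans (≡-sym (setEdge-off G v≢y false
    λ { (inj₁ (e , _)) → z≢v e ; (inj₂ (e , _)) → z≢y e })) zx
  zyG : adj G z y ≡ false
  zyG = trans (≡-sym (setEdge-off G v≢y false
    λ { (inj₁ (e , _)) → z≢v e ; (inj₂ (e , _)) → z≢y e })) zy

-- The Erdős–Gallai criterion

size : ∀ {n} → (Fin n → Bool) → ℕ
size B = sum (𝟙 ∘ B)

into : ∀ {n} → Graph n → (Fin n → Bool) → Fin n → ℕ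
into G B j = sum (λ i → 𝟙 (B i ∧ adj G i j))

total : ∀ {n} → (Fin n → Bool) → (Fin n → ℕ) → ℕ
total B f = sum (λ i → if B i then f i else 0)

-- The largest number of neighbours in B that a vertex j of degree f j can have;
-- the Erdős–Gallai inequality for B is total B f ≤ sum (cap B f).
cap : ∀ {n} → (Fin n → Bool) → (Fin n → ℕ) → Fin n → ℕ
cap B f j = if B j then ℕ.pred (size B) else size B ⊓ f j

total-deg : ∀ {n} (G : Graph n) B → total B (deg G) ≡ sum (into G B)
total-deg {n} G B = trans (sum-cong-≗ rows) (∑-comm (λ i j → 𝟙 (B i ∧ adj G i j)))
  where
  rows : ∀ i → (if B i then deg G i else 0) ≡ sum (λ j → 𝟙 (B i ∧ adj G i j))
  rows i with B i
  ... | true  = refl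
  ... | false = ≡-sym (sum-replicate-zero n)

𝟙-∧≤ˡ : ∀ b c → 𝟙 (b ∧ c) ≤ 𝟙 b
𝟙-∧≤ˡ true  c = 𝟙≤1 c
𝟙-∧≤ˡ false c = z≤n

𝟙-∧≤ʳ : ∀ b c → 𝟙 (b ∧ c) ≤ 𝟙 c
𝟙-∧≤ʳ true  c = ℕₚ.≤-refl
𝟙-∧≤ʳ false c = z≤n

into≤size : ∀ {n} (G : Graph n) B j → into G B j ≤ size B
into≤size G B j = sum-mono λ i → 𝟙-∧≤ˡ (B i) _

into≤deg : ∀ {n} (G : Graph n) B j → into G B j ≤ deg G j
into≤deg G B j = sum-mono λ i →
  subst (λ b → 𝟙 (B i ∧ adj G i j) ≤ 𝟙 b) (Graph.sym G i j) (𝟙-∧≤ʳ (B i) _)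

into-self-≤ : ∀ {n} (G : Graph n) (B : Fin n → Bool) j → B j ≡ true → ∀ i → 𝟙 (B i ∧ adj G i j) + δF j i ≤ 𝟙 (B i)
into-self-≤ G B j Bj i with j ≟ i
... | yes refl rewrite Bj | irrefl G j | δ-refl (toℕ j) = ℕₚ.≤-refl
... | no j≢i rewrite δF-≢ j≢i = subst (_≤ 𝟙 (B i)) (≡-sym (ℕₚ.+-identityʳ _)) (𝟙-∧≤ˡ (B i) _)

into<size : ∀ {n} (G : Graph n) B j → B j ≡ true → into G B j < size B
into<size G B j Bj =
  subst (_≤ size B) (sum-+δF (λ i → 𝟙 (B i ∧ adj G i j)) j) (sum-mono (into-self-≤ G B j Bj))

into≤cap : ∀ {n} (G : Graph n) B j → into G B j ≤ cap B (deg G) j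
into≤cap G B j with B j in Bj
... | true  = ℕₚ.<⇒≤pred (into<size G B j Bj)
... | false = ℕₚ.⊓-glb (into≤size G B j) (into≤deg G B j)

missing-in : ∀ {n} (G : Graph n) B j → into G B j < size B →
  ∃ λ i → B i ≡ true × adj G i j ≡ false
missing-in G B j lt with sum-<⇒∃< lt
... | i , l with B i in Bi | adj G i j in aij
...   | true  | false = i , Bi , aij
...   | true  | true  = contradiction l (ℕₚ.<-irrefl refl)
...   | false | _     = contradiction l λ ()

nbr-outside : ∀ {n} (G : Graph n) B j → into G B j < deg G j →
  ∃ λ i → B i ≡ false × adj G i j ≡ true
nbr-outside G B j lt with sum-<⇒∃< lt
... | i , l with B i in Bi | adj G i j in aij
...   | false | true  = i , Bi , aij
...   | true  | true  = contradiction (subst (λ b → 1 < 𝟙 b) (adj-sym G aij) l) (ℕₚ.<-irrefl refl)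
...   | true  | false = contradiction (subst (λ b → 0 < 𝟙 b) (adj-sym G aij) l) λ ()
...   | false | false = contradiction (subst (λ b → 0 < 𝟙 b) (adj-sym G aij) l) λ ()

-- The bound is inclusive, so the set is never empty; `r` itself later serves as a vertex of role B.
upto : ∀ {n} → Fin n → Fin n → Bool
upto r i = does (toℕ i ≤? toℕ r)

upto-true : ∀ {n} {r i : Fin n} → upto r i ≡ true → toℕ i ≤ toℕ r
upto-true {r = r} {i} eq = ℕₚ.≮⇒≥ λ r<i →
  true≢false eq (dec-false (toℕ i ≤? toℕ r) (ℕₚ.<⇒≱ r<i))

upto-false : ∀ {n} {r i : Fin n} → upto r i ≡ false → toℕ r < toℕ i
upto-false {r = r} {i} eq = ℕₚ.≰⇒> λ i≤r →
  true≢false (dec-true (toℕ i ≤? toℕ r) i≤r) eq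

upto-≤ : ∀ {n} {r i : Fin n} → toℕ i ≤ toℕ r → upto r i ≡ true
upto-≤ {r = r} {i} le = dec-true (toℕ i ≤? toℕ r) le

upto-> : ∀ {n} {r i : Fin n} → toℕ r < toℕ i → upto r i ≡ false
upto-> {r = r} {i} lt = dec-false (toℕ i ≤? toℕ r) (ℕₚ.<⇒≱ lt)

-- A realization or a violated inequality, one vertex at a time

Violation : ∀ {n} → (Fin n → ℕ) → Set
Violation {n} f = Σ (Fin n) λ r → sum (cap (upto r) f) < total (upto r) f

-- The algorithm of Tripathi, Venugopalan and West: vertices before r have their final degree,
-- and vertices after r are not yet joined to each other.
record Partial {n} (f : Fin n → ℕ) (r : ℕ) : Set where
  field
    graph : Graph n
    exact : ∀ i → toℕ i < r → deg graph i ≡ f i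
    below : ∀ i → deg graph i ≤ f i
    indep : ∀ u v → r < toℕ u → r < toℕ v → adj graph u v ≡ false

-- What preserves `indep`: every pair that a surgery changes has an end at or before `r`.
AgreeAbove : ∀ {n} → ℕ → Graph n → Graph n → Set
AgreeAbove r G G′ = ∀ u v → r < toℕ u → r < toℕ v → adj G′ u v ≡ adj G u v

even≢odd : ∀ s t → t + t ≢ suc (s + s)
even≢odd s       zero    ()
even≢odd zero    (suc t) eq rewrite ℕₚ.+-suc t t with () ← eq
even≢odd (suc s) (suc t) eq rewrite ℕₚ.+-suc t t | ℕₚ.+-suc s s =
  even≢odd s t (ℕₚ.suc-injective (ℕₚ.suc-injective eq))

move-agreeᶻ : ∀ {n r} {G : Graph n} {z x y} (M : Move G z x y) → toℕ z ≤ r →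
  AgreeAbove r G (Move.graph M)
move-agreeᶻ M z≤r u v r<u r<v = Move.adj-off M clash clash
  where
  clash : ∀ {w} → ¬ Pair _ w u v
  clash (inj₁ (refl , _)) = ℕₚ.<⇒≱ r<u z≤r
  clash (inj₂ (_ , refl)) = ℕₚ.<⇒≱ r<v z≤r

move-agreeˣʸ : ∀ {n r} {G : Graph n} {z x y} (M : Move G z x y) → toℕ x ≤ r → toℕ y ≤ r →
  AgreeAbove r G (Move.graph M)
move-agreeˣʸ {r = r} M x≤r y≤r u v r<u r<v = Move.adj-off M (clash x≤r) (clash y≤r)
  where
  clash : ∀ {w} → toℕ w ≤ r → ¬ Pair _ w u v
  clash w≤r (inj₁ (_ , refl)) = ℕₚ.<⇒≱ r<v w≤r
  clash w≤r (inj₂ (refl , _)) = ℕₚ.<⇒≱ r<u w≤r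

add-agree : ∀ {n r} (G : Graph n) {x y} (x≢y : x ≢ y) → toℕ x ≤ r →
  AgreeAbove r G (setEdge G x≢y true)
add-agree G x≢y x≤r u v r<u r<v = setEdge-off G x≢y true λ
  { (inj₁ (refl , _)) → ℕₚ.<⇒≱ r<u x≤r ; (inj₂ (_ , refl)) → ℕₚ.<⇒≱ r<v x≤r }

module _ {n} (f : Fin n → ℕ) (sorted : ∀ i j → toℕ i ≤ toℕ j → f j ≤ f i)
         (even : ∃ λ t → sum f ≡ t + t) where

  module Step (r : Fin n) (P : Partial f (toℕ r)) (deficient : deg (Partial.graph P) r < f r) where
    open Partial P renaming (graph to H)

    Progress : Set
    Progress = Σ (Partial f (toℕ r)) λ P′ → deg H r < deg (Partial.graph P′) r

    -- A unit of degree passes from `w` to `r`. As `w` comes after `r`, its degree is not final and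
    -- may drop.
    swap-progress : ∀ (H′ : Graph n) w → toℕ r < toℕ w →
      (∀ l → deg H′ l + δF w l ≡ deg H l + δF r l) → AgreeAbove (toℕ r) H H′ → Progress
    swap-progress H′ w r<w eqs agree = record
      { graph = H′
      ; exact = λ i i<r → trans (same i (λ { refl → ℕₚ.<-asym r<w i<r }) (λ { refl → ℕₚ.<-irrefl refl i<r })) (exact i i<r)
      ; below = below′
      ; indep = λ u v r<u r<v → trans (agree u v r<u r<v) (indep u v r<u r<v)
      } , ℕₚ.≤-reflexive (≡-sym gain)
      where
      same : ∀ l → l ≢ w → l ≢ r → deg H′ l ≡ deg H l
      same l l≢w l≢r = trans (≡-sym (ℕₚ.+-identityʳ _)) (trans
        (subst₂ (λ a b → deg H′ l + a ≡ deg H l + b) (δF-≢ (l≢w ∘ ≡-sym)) (δF-≢ (l≢r ∘ ≡-sym)) (eqs l))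
        (ℕₚ.+-identityʳ _))
      r≢w : r ≢ w
      r≢w refl = ℕₚ.<-irrefl refl r<w
      gain : deg H′ r ≡ suc (deg H r)
      gain = trans (≡-sym (ℕₚ.+-identityʳ _)) (trans
        (subst₂ (λ a b → deg H′ r + a ≡ deg H r + b) (δF-≢ (r≢w ∘ ≡-sym)) (δ-refl (toℕ r)) (eqs r))
        (ℕₚ.+-comm _ 1))
      below′ : ∀ l → deg H′ l ≤ f l
      below′ l with l ≟ r
      ... | yes refl = subst (_≤ f l) (≡-sym gain) deficient
      ... | no l≢r = ℕₚ.≤-trans (ℕₚ.m≤m+n _ _) (subst (_≤ f l)
          (trans (≡-sym (trans (cong (deg H l +_) (δF-≢ (l≢r ∘ ≡-sym))) (ℕₚ.+-identityʳ _))) (≡-sym (eqs l))) (below l))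

    -- The case k = r is a gain of two at r.
    add-progress : ∀ (H′ : Graph n) k → (∀ l → deg H′ l ≡ deg H l + δF r l + δF k l) →
      (∀ l → deg H l + δF r l + δF k l ≤ f l) → AgreeAbove (toℕ r) H H′ → Progress
    add-progress H′ k eqs room agree = record
      { graph = H′
      ; exact = λ i i<r → ℕₚ.≤-antisym (below′ i)
          (subst (f i ≤_) (≡-sym (eqs i)) (subst (_≤ deg H i + δF r i + δF k i) (exact i i<r)
            (ℕₚ.≤-trans (ℕₚ.m≤m+n _ _) (ℕₚ.m≤m+n _ _))))
      ; below = below′
      ; indep = λ u v r<u r<v → trans (agree u v r<u r<v) (indep u v r<u r<v)
      } , subst (deg H r <_) (≡-sym (eqs r))
            (ℕₚ.≤-trans (ℕₚ.≤-reflexive (trans (ℕₚ.+-comm 1 _) (cong (deg H r +_) (≡-sym (δ-refl (toℕ r))))))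
                        (ℕₚ.m≤m+n _ (δF k r)))
      where
      below′ : ∀ l → deg H′ l ≤ f l
      below′ l = subst (_≤ f l) (≡-sym (eqs l)) (room l)

    room-≢ : ∀ {k} → k ≢ r → deg H k < f k → ∀ l → deg H l + δF r l + δF k l ≤ f l
    room-≢ {k} k≢r dk l with r ≟ l | k ≟ l
    ... | yes refl | yes e = contradiction e k≢r
    ... | yes refl | no k≢l rewrite δ-refl (toℕ r) | δF-≢ k≢l =
      subst (_≤ f r) (trans (ℕₚ.+-comm 1 _) (≡-sym (ℕₚ.+-identityʳ _))) deficient
    ... | no r≢l | yes refl rewrite δ-refl (toℕ k) | δF-≢ r≢l =
      subst (_≤ f k) (trans (ℕₚ.+-comm 1 _) (cong (_+ 1) (≡-sym (ℕₚ.+-identityʳ _)))) dk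
    ... | no r≢l | no k≢l rewrite δF-≢ r≢l | δF-≢ k≢l =
      subst (_≤ f l) (≡-sym (trans (ℕₚ.+-identityʳ _) (ℕₚ.+-identityʳ _))) (below l)

    deficient⇒> : ∀ {k} → k ≢ r → deg H k < f k → toℕ r < toℕ k
    deficient⇒> {k} k≢r dk with ℕₚ.<-cmp (toℕ k) (toℕ r)
    ... | tri< k<r _ _ = contradiction (exact k k<r) (ℕₚ.<⇒≢ dk)
    ... | tri≈ _ e _   = contradiction (toℕ-injective e) k≢r
    ... | tri> _ _ r<k = r<k

    -- Here sortedness enters: an earlier vertex already has degree `f i`, which is at least `f r`
    -- and so exceeds the present degree of `r`.
    private-nbr : ∀ {i} → toℕ i < toℕ r → ∃ λ u → adj H u i ≡ true × adj H u r ≡ false × u ≢ r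
    private-nbr {i} i<r = exchange-< H (ℕₚ.<-≤-trans deficient
      (subst (f r ≤_) (≡-sym (exact i i<r)) (sorted i r (ℕₚ.<⇒≤ i<r))))

    B : Fin n → Bool
    B = upto r

    -- Moving `ui` to `ur` helps `r` but takes a unit from `i`. If another vertex `k` is deficient,
    -- `i` is repaid by moving `rk` to `ri`, at the cost of `k`. Otherwise `i` is repaid by the new
    -- edge `ir`, and `r` gains two.
    nonadjacent-below : ∀ {i} → toℕ i < toℕ r → adj H r i ≡ false →
      (∀ k → k ≢ r → deg H k < f k → adj H r k ≡ true) → Progress
    nonadjacent-below {i} i<r ri saturated with private-nbr i<r
    ... | u , ui , ur , u≢r with any? (λ k → ¬? (k ≟ r) ×-dec deg H k ℕ.<? f k)
    ...   | yes (k , k≢r , dk) = swap-progress M₂.graph k (deficient⇒> k≢r dk)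
              (λ l → trans (M₂.deg-eq l) (M₁.deg-eq l))
              λ x y r<x r<y → trans (move-agreeᶻ m₂ ℕₚ.≤-refl x y r<x r<y)
                (move-agreeˣʸ m₁ (ℕₚ.<⇒≤ i<r) ℕₚ.≤-refl x y r<x r<y)
      where
      rk = saturated k k≢r dk
      r≢i : r ≢ i
      r≢i refl = ℕₚ.<-irrefl refl i<r
      m₁ = move H ui ur u≢r
      module M₁ = Move m₁
      rk₁ : adj M₁.graph r k ≡ true
      rk₁ = trans (M₁.adj-off
        (λ { (inj₁ (e , _)) → u≢r (≡-sym e) ; (inj₂ (e , _)) → r≢i e })
        (λ { (inj₁ (e , _)) → u≢r (≡-sym e) ; (inj₂ (_ , refl)) → true≢false (adj-sym H rk) ur })) rk
      ri₁ : adj M₁.graph r i ≡ false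
      ri₁ = trans (M₁.adj-off
        (λ { (inj₁ (e , _)) → u≢r (≡-sym e) ; (inj₂ (e , _)) → r≢i e })
        (λ { (inj₁ (e , _)) → u≢r (≡-sym e) ; (inj₂ (_ , e)) → adj⇒≢ H ui (≡-sym e) })) ri
      m₂ = move M₁.graph rk₁ ri₁ r≢i
      module M₂ = Move m₂
    ...   | no none = add-progress (setEdge M₁.graph i≢r true) r degs room
              λ x y r<x r<y → trans (add-agree M₁.graph i≢r (ℕₚ.<⇒≤ i<r) x y r<x r<y)
                (move-agreeˣʸ m₁ (ℕₚ.<⇒≤ i<r) ℕₚ.≤-refl x y r<x r<y)
      where
      i≢r : i ≢ r
      i≢r refl = ℕₚ.<-irrefl refl i<r
      m₁ = move H ui ur u≢r
      module M₁ = Move m₁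
      ir₁ : adj M₁.graph i r ≡ false
      ir₁ = trans (M₁.adj-off
        (λ { (inj₁ (_ , e)) → i≢r (≡-sym e) ; (inj₂ (_ , e)) → u≢r (≡-sym e) })
        (λ { (inj₁ (e , _)) → adj⇒≢ H ui (≡-sym e) ; (inj₂ (e , _)) → i≢r e })) (adj-sym H ri)
      degs : ∀ l → deg (setEdge M₁.graph i≢r true) l ≡ deg H l + δF r l + δF r l
      degs l = trans (addEdge-deg M₁.graph i≢r ir₁ l) (cong (_+ δF r l) (M₁.deg-eq l))
      full : ∀ l → l ≢ r → deg H l ≡ f l
      full l l≢r = ℕₚ.≤-antisym (below l) (ℕₚ.≮⇒≥ λ lt → none (l , l≢r , lt))
      -- All other degrees are final, so a gap of exactly 1 at `r` would make the sum of `f` one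
      -- more than a degree sum, hence odd. This leaves room for the gain of two.
      parity : suc (deg H r) ≢ f r
      parity e = even≢odd (proj₁ (deg-sum-even H)) (proj₁ even)
        (trans (≡-sym (proj₂ even)) (trans (sum-cong-≗ pointwise) (trans (sum-+δF (deg H) r)
          (cong suc (proj₂ (deg-sum-even H))))))
        where
        pointwise : ∀ l → f l ≡ deg H l + δF r l
        pointwise l with r ≟ l
        ... | yes refl = trans (≡-sym e) (trans (ℕₚ.+-comm 1 _) (cong (deg H r +_) (≡-sym (δ-refl (toℕ r)))))
        ... | no r≢l = trans (≡-sym (full l (r≢l ∘ ≡-sym)))
              (trans (≡-sym (ℕₚ.+-identityʳ _)) (cong (deg H l +_) (≡-sym (δF-≢ r≢l))))
      room : ∀ l → deg H l + δF r l + δF r l ≤ f l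
      room l with r ≟ l
      ... | yes refl rewrite δ-refl (toℕ r) | ℕₚ.+-assoc (deg H r) 1 1 | ℕₚ.+-comm (deg H r) 2 =
        ℕₚ.≤∧≢⇒< deficient parity
      ... | no r≢l rewrite δF-≢ r≢l =
        subst (_≤ f l) (≡-sym (trans (ℕₚ.+-identityʳ _) (ℕₚ.+-identityʳ _))) (below l)

    module _ (saturated : ∀ k → k ≢ r → deg H k < f k → adj H r k ≡ true)
             (joined : ∀ i → toℕ i < toℕ r → adj H r i ≡ true) where

      -- A degree below `size B` means that `k` misses some `i` in `B`, and `i` is not `r` because
      -- `k` is deficient and therefore joined to `r`. After `ui` is moved to `ur`, the edge `ik`
      -- repays `i` and also helps `k`.
      uncapped-above : ∀ {k} → toℕ r < toℕ k → deg H k < size B ⊓ f k → Progress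
      uncapped-above {k} r<k dk with missing-in H B k
        (ℕₚ.≤-<-trans (into≤deg H B k) (ℕₚ.m<n⊓o⇒m<n _ _ dk))
      ... | i , Bi , ik = result (private-nbr i<r)
        where
        dk<fk = ℕₚ.m<n⊓o⇒m<o _ _ dk
        k≢r : k ≢ r
        k≢r refl = ℕₚ.<-irrefl refl r<k
        rk = saturated k k≢r dk<fk
        i≢r : i ≢ r
        i≢r refl = true≢false rk ik
        i<r = ℕₚ.≤∧≢⇒< (upto-true {r = r} Bi) (i≢r ∘ toℕ-injective)
        i≢k : i ≢ k
        i≢k refl = ℕₚ.<-asym r<k i<r
        result : (∃ λ u → adj H u i ≡ true × adj H u r ≡ false × u ≢ r) → Progress
        result (u , ui , ur , u≢r) = add-progress (setEdge M₁.graph i≢k true) k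
          (λ l → trans (addEdge-deg M₁.graph i≢k ik₁ l) (cong (_+ δF k l) (M₁.deg-eq l)))
          (room-≢ k≢r dk<fk)
          λ x y r<x r<y → trans (add-agree M₁.graph i≢k (ℕₚ.<⇒≤ i<r) x y r<x r<y)
                (move-agreeˣʸ m₁ (ℕₚ.<⇒≤ i<r) ℕₚ.≤-refl x y r<x r<y)
          where
          m₁ = move H ui ur u≢r
          module M₁ = Move m₁
          ik₁ : adj M₁.graph i k ≡ false
          ik₁ = trans (M₁.adj-off
            (λ { (inj₁ (_ , e)) → i≢k (≡-sym e) ; (inj₂ (_ , refl)) → true≢false (adj-sym H rk) ur })
            (λ { (inj₁ (_ , e)) → k≢r e ; (inj₂ (e , _)) → i≢r e })) ik

      -- Moving `ui` to `ur` and then `jw` to `ji` repays `i`, so the unit for `r` comes from `w`.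
      -- The vertex `w` lies after `r` since `r` is joined to everything before it; `u` and `w` may
      -- coincide.
      nonclique-below : ∀ {i j} → toℕ i < toℕ r → toℕ j < toℕ r → i ≢ j → adj H i j ≡ false → Progress
      nonclique-below {i} {j} i<r j<r i≢j ij with private-nbr i<r | private-nbr j<r
      ... | u , ui , ur , u≢r | w , wj , wr , w≢r =
        swap-progress M₂.graph w r<w (λ l → trans (M₂.deg-eq l) (M₁.deg-eq l))
          λ x y r<x r<y → trans (move-agreeᶻ m₂ (ℕₚ.<⇒≤ j<r) x y r<x r<y)
                (move-agreeˣʸ m₁ (ℕₚ.<⇒≤ i<r) ℕₚ.≤-refl x y r<x r<y)
        where
        r<w : toℕ r < toℕ w
        r<w = ℕₚ.≤∧≢⇒< (ℕₚ.≮⇒≥ λ w<r → true≢false (adj-sym H (joined w w<r)) wr)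
                        (w≢r ∘ ≡-sym ∘ toℕ-injective)
        j≢u : j ≢ u
        j≢u refl = true≢false (adj-sym H (joined j j<r)) ur
        j≢r : j ≢ r
        j≢r refl = ℕₚ.<-irrefl refl j<r
        m₁ = move H ui ur u≢r
        module M₁ = Move m₁
        jw₁ : adj M₁.graph j w ≡ true
        jw₁ = trans (M₁.adj-off
          (λ { (inj₁ (e , _)) → j≢u e ; (inj₂ (e , _)) → i≢j (≡-sym e) })
          (λ { (inj₁ (e , _)) → j≢u e ; (inj₂ (e , _)) → j≢r e })) (adj-sym H wj)
        ji₁ : adj M₁.graph j i ≡ false
        ji₁ = trans (M₁.adj-off
          (λ { (inj₁ (e , _)) → j≢u e ; (inj₂ (e , _)) → i≢j (≡-sym e) })
          (λ { (inj₁ (e , _)) → j≢u e ; (inj₂ (e , _)) → j≢r e })) (adj-sym H ij)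
        m₂ = move M₁.graph jw₁ ji₁ (i≢j ∘ ≡-sym)
        module M₂ = Move m₂

      -- If nothing can be improved, every vertex reaches its cap: `B` is a clique, and later
      -- vertices have all their neighbours in `B`. Since `r` still lacks degree, counting edge ends
      -- at `B` shows that the demand exceeds the caps.
      violation : (∀ k → toℕ r < toℕ k → size B ⊓ f k ≤ deg H k) →
        (∀ i j → toℕ i < toℕ r → toℕ j < toℕ r → i ≢ j → adj H i j ≡ true) → Violation f
      violation capped clique = r , (begin-strict
        sum (cap B f)     ≤⟨ sum-mono cap≤into ⟩
        sum (into H B)    ≡⟨ total-deg H B ⟨
        total B (deg H)   <⟨ sum-mono-< total≤ r total<at-r ⟩
        total B f         ∎)
        where
        open ℕₚ.≤-Reasoning
        clique′ : ∀ i j → toℕ i ≤ toℕ r → toℕ j ≤ toℕ r → i ≢ j → adj H i j ≡ true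
        clique′ i j i≤r j≤r i≢j with i ≟ r | j ≟ r
        ... | yes refl | yes refl = contradiction refl i≢j
        ... | yes refl | no j≢r = joined j (ℕₚ.≤∧≢⇒< j≤r (j≢r ∘ toℕ-injective))
        ... | no i≢r | yes refl = adj-sym H (joined i (ℕₚ.≤∧≢⇒< i≤r (i≢r ∘ toℕ-injective)))
        ... | no i≢r | no j≢r = clique i j (ℕₚ.≤∧≢⇒< i≤r (i≢r ∘ toℕ-injective))
                                           (ℕₚ.≤∧≢⇒< j≤r (j≢r ∘ toℕ-injective)) i≢j
        cap≤into : ∀ j → cap B f j ≤ into H B j
        cap≤into j with B j in Bj
        ... | true = ℕₚ.pred-mono-≤ (subst (size B ≤_) (sum-+δF (λ i → 𝟙 (B i ∧ adj H i j)) j)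
                       (sum-mono pointwise))
          where
          pointwise : ∀ i → 𝟙 (B i) ≤ 𝟙 (B i ∧ adj H i j) + δF j i
          pointwise i with B i in Bi | j ≟ i
          ... | false | _ = z≤n
          ... | true | yes refl rewrite δ-refl (toℕ j) = ℕₚ.m≤n+m 1 _
          ... | true | no j≢i rewrite clique′ i j (upto-true {r = r} Bi) (upto-true {r = r} Bj) (j≢i ∘ ≡-sym) = s≤s z≤n
        ... | false = ℕₚ.≤-trans (capped j r<j) (sum-mono pointwise)
          where
          r<j = upto-false {r = r} Bj
          pointwise : ∀ i → 𝟙 (adj H j i) ≤ 𝟙 (B i ∧ adj H i j)
          pointwise i with B i in Bi
          ... | true  = ℕₚ.≤-reflexive (cong 𝟙 (Graph.sym H j i))
          ... | false rewrite indep j i r<j (upto-false {r = r} Bi) = z≤n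
        total≤ : ∀ i → (if B i then deg H i else 0) ≤ (if B i then f i else 0)
        total≤ i with B i
        ... | true  = below i
        ... | false = z≤n
        total<at-r : (if B r then deg H r else 0) < (if B r then f r else 0)
        total<at-r rewrite upto-≤ {r = r} {r} ℕₚ.≤-refl = deficient

    step : Violation f ⊎ Progress
    step with any? (λ k → ¬? (k ≟ r) ×-dec adj H r k Bool.≟ false ×-dec deg H k ℕ.<? f k)
    ... | yes (k , k≢r , rk , dk) = inj₂ (add-progress (setEdge H r≢k true) k
            (addEdge-deg H r≢k rk) (room-≢ k≢r dk) (add-agree H r≢k ℕₚ.≤-refl))
      where r≢k = k≢r ∘ ≡-sym
    ... | no none₀ with any? (λ i → toℕ i ℕ.<? toℕ r ×-dec adj H r i Bool.≟ false)
    ...   | yes (i , i<r , ri) = inj₂ (nonadjacent-below i<r ri λ k k≢r dk →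
              ¬-not λ rk → none₀ (k , k≢r , rk , dk))
    ...   | no none₁ = rest
      where
      saturated : ∀ k → k ≢ r → deg H k < f k → adj H r k ≡ true
      saturated k k≢r dk = ¬-not λ rk → none₀ (k , k≢r , rk , dk)
      joined : ∀ i → toℕ i < toℕ r → adj H r i ≡ true
      joined i i<r = ¬-not λ ri → none₁ (i , i<r , ri)
      rest : Violation f ⊎ Progress
      rest with any? (λ k → toℕ r ℕ.<? toℕ k ×-dec deg H k ℕ.<? size B ⊓ f k)
      ... | yes (k , r<k , dk) = inj₂ (uncapped-above saturated joined r<k dk)
      ... | no none₂ with any? (λ i → any? λ j → toℕ i ℕ.<? toℕ r ×-dec toℕ j ℕ.<? toℕ r
                                     ×-dec ¬? (i ≟ j) ×-dec adj H i j Bool.≟ false)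
      ...   | yes (i , j , i<r , j<r , i≢j , ij) = inj₂ (nonclique-below saturated joined i<r j<r i≢j ij)
      ...   | no none₃ = inj₁ (violation saturated joined
                (λ k r<k → ℕₚ.≮⇒≥ λ dk → none₂ (k , r<k , dk))
                (λ i j i<r j<r i≢j → ¬-not λ ij → none₃ (i , j , i<r , j<r , i≢j , ij)))

  -- The fuel bounds the missing degree of `r`, which every round of `step` decreases.
  saturate : ∀ r fuel (P : Partial f (toℕ r)) → f r ≤ fuel + deg (Partial.graph P) r →
    Violation f ⊎ Partial f (suc (toℕ r))
  saturate r fuel P bound with deg (Partial.graph P) r ℕ.<? f r
  ... | no done = inj₂ (record
      { graph = graph
      ; exact = λ i i<1+r → exact′ i (ℕₚ.m≤n⇒m<n∨m≡n (ℕₚ.≤-pred i<1+r))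
      ; below = below
      ; indep = λ u v r<u r<v → indep u v (ℕₚ.<⇒≤ r<u) (ℕₚ.<⇒≤ r<v)
      })
    where
    open Partial P
    exact′ : ∀ i → toℕ i < toℕ r ⊎ toℕ i ≡ toℕ r → deg graph i ≡ f i
    exact′ i (inj₁ i<r) = exact i i<r
    exact′ i (inj₂ e) rewrite toℕ-injective e = ℕₚ.≤-antisym (below r) (ℕₚ.≮⇒≥ done)
  saturate r zero       P bound | yes lt = contradiction bound (ℕₚ.<⇒≱ lt)
  saturate r (suc fuel) P bound | yes lt with Step.step r P lt
  ... | inj₁ v = inj₁ v
  ... | inj₂ (P′ , gain) = saturate r fuel P′
      (ℕₚ.≤-trans bound (subst (_≤ fuel + deg (Partial.graph P′) r) (ℕₚ.+-suc fuel _)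
        (ℕₚ.+-monoʳ-≤ fuel gain)))

  build : ∀ r → r ≤ n → Violation f ⊎ Partial f r
  build zero _ = inj₂ (record
    { graph = record { adj = λ _ _ → false ; sym = λ _ _ → refl ; irrefl = λ _ → refl }
    ; exact = λ _ ()
    ; below = λ i → subst (_≤ f i) (≡-sym (sum-replicate-zero n)) z≤n
    ; indep = λ _ _ _ _ → refl })
  build (suc r) r<n with build r (ℕₚ.<⇒≤ r<n)
  ... | inj₁ v = inj₁ v
  ... | inj₂ P = subst (λ k → Partial f k → Violation f ⊎ Partial f (suc k)) (toℕ-fromℕ< r<n)
      (λ P → saturate (fromℕ< r<n) (f (fromℕ< r<n)) P (ℕₚ.m≤m+n _ _)) P

  erdős–gallai : Violation f ⊎ Σ (Graph n) λ G → ∀ i → deg G i ≡ f i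
  erdős–gallai with build n ℕₚ.≤-refl
  ... | inj₁ v = inj₁ v
  ... | inj₂ P = inj₂ (Partial.graph P , λ i → Partial.exact P i (toℕ<n i))

-- Forced pairs and tight inequalities

HasDegrees : ∀ {n} → Graph n → (Fin n → ℕ) → Set
HasDegrees G f = ∀ i → deg G i ≡ f i

Forced : ∀ {n} → Bool → (Fin n → ℕ) → Fin n → Fin n → Set
Forced b f u v = ∀ G → HasDegrees G f → adj G u v ≡ b

-- If a realization lacked `xv`, then `x`, of degree at least that of `u`, would have a neighbour
-- `z` not adjacent to `u`. Switching `vu`, `xz` to `vx`, `uz` would destroy the forced edge.
forced-edge-shift : ∀ {n} {f : Fin n → ℕ} {u v x} → Forced true f u v → f u ≤ f x → x ≢ v →
  Forced true f x v
forced-edge-shift {f = f} {u} {v} {x} forced fu≤fx x≢v G degs = ¬-not λ xv → absurd xv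
  where
  absurd : adj G x v ≢ false
  absurd xv with exchange-≤ G (subst₂ _≤_ (≡-sym (degs u)) (≡-sym (degs x)) fu≤fx)
                   (adj-sym G (forced G degs)) (adj-sym G xv) (x≢v ∘ ≡-sym)
  ... | z , zx , zu , z≢u with switch G (adj-sym G (forced G degs)) (adj-sym G zx)
                               (adj-sym G xv) (adj-sym G zu) (x≢v ∘ ≡-sym) (z≢u ∘ ≡-sym)
  ...   | G′ , same , _ , vu = true≢false (adj-sym G′ (forced G′ λ i → trans (same i) (degs i))) vu

forced-nonedge-shift : ∀ {n} {f : Fin n → ℕ} {u v x} → u ≢ v → Forced false f u v → f x ≤ f u →
  Forced false f x v
forced-nonedge-shift {f = f} {u} {v} {x} u≢v forced fx≤fu G degs = ¬-not λ xv → absurd xv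
  where
  absurd : adj G x v ≢ true
  absurd xv with exchange-≤ G (subst₂ _≤_ (≡-sym (degs x)) (≡-sym (degs u)) fx≤fu)
                   (adj-sym G xv) (adj-sym G (forced G degs)) (u≢v ∘ ≡-sym)
  ... | z , zu , zx , z≢x with switch G (adj-sym G xv) (adj-sym G zu)
                               (adj-sym G (forced G degs)) (adj-sym G zx) (u≢v ∘ ≡-sym) (z≢x ∘ ≡-sym)
  ...   | G′ , same , vu , _ = true≢false (adj-sym G′ vu) (forced G′ λ i → trans (same i) (degs i))

-- Stated for an arbitrary relation so that it serves both the two largest and the two smallest
-- degrees. The ends are shifted one at a time; if `j` is already `s`, shifting `i` to `s` would
-- make the ends collide, so `i` goes to `t` instead.
to-extremes : ∀ {n} {F R : Fin n → Fin n → Set} {s t i j} →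
  (∀ {u v} → F u v → F v u) →
  (∀ {u v x} → u ≢ v → x ≢ v → F u v → R u x → F x v) →
  (∀ u → R u s) → (∀ u → u ≢ s → R u t) → s ≢ t → i ≢ j → F i j → F s t
to-extremes {n} {F} {s = s} {t} {i} {j} F-sym shift R-s R-t s≢t i≢j Fij with j ≟ s
... | yes refl = F-sym (shift i≢j (s≢t ∘ ≡-sym) Fij (R-t i i≢j))
... | no j≢s = F-sym (shift j≢s (s≢t ∘ ≡-sym) (F-sym (shift i≢j (j≢s ∘ ≡-sym) Fij (R-s i))) (R-t j j≢s))

Tight : ∀ {n} → (Fin n → ℕ) → Set
Tight {n} f = Σ (Fin n) λ r → sum (cap (upto r) f) ≤ suc (total (upto r) f)

cap-mono : ∀ {n} {f g : Fin n → ℕ} B → (∀ i → f i ≤ g i) → ∀ j → cap B f j ≤ cap B g j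
cap-mono B f≤g j with B j
... | true  = ℕₚ.≤-refl
... | false = ℕₚ.⊓-monoʳ-≤ (size B) (f≤g j)

cap-+ : ∀ {n} {f g h : Fin n → ℕ} B → (∀ i → f i ≤ g i + h i) → ∀ j → cap B f j ≤ cap B g j + h j
cap-+ {g = g} {h} B f≤ j with B j
... | true  = ℕₚ.m≤m+n _ _
... | false = ℕₚ.≤-trans (ℕₚ.⊓-mono-≤ (ℕₚ.m≤m+n (size B) (h j)) (f≤ j))
                         (ℕₚ.≤-reflexive (≡-sym (ℕₚ.+-distribʳ-⊓ (h j) (size B) (g j))))

total-mono : ∀ {n} {f g : Fin n → ℕ} B → (∀ i → f i ≤ g i) → total B f ≤ total B g
total-mono B f≤g = sum-mono λ i → pointwise i
  where
  pointwise : ∀ i → (if B i then _ else 0) ≤ (if B i then _ else 0)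
  pointwise i with B i
  ... | true  = f≤g i
  ... | false = z≤n

total-+ : ∀ {n} (f h : Fin n → ℕ) B → total B (λ i → f i + h i) ≤ total B f + sum h
total-+ f h B = ℕₚ.≤-trans (sum-mono pointwise) (ℕₚ.≤-reflexive (∑-distrib-+ _ h))
  where
  pointwise : ∀ i → (if B i then f i + h i else 0) ≤ (if B i then f i else 0) + h i
  pointwise i with B i
  ... | true  = ℕₚ.≤-refl
  ... | false = z≤n

twoδ : ∀ {n} → Fin n → Fin n → Fin n → ℕ
twoδ p q i = δF p i + δF q i

sum-twoδ : ∀ {n} (p q : Fin n) → sum (twoδ p q) ≡ 2
sum-twoδ p q = trans (∑-distrib-+ (δF p) (δF q)) (cong₂ _+_ (sum-δF p) (sum-δF q))

twoδˡ : ∀ {n} {p q : Fin n} → p ≢ q → twoδ p q p ≡ 1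
twoδˡ {p = p} p≢q = cong₂ _+_ (δ-refl (toℕ p)) (δF-≢ (p≢q ∘ ≡-sym))

twoδʳ : ∀ {n} {p q : Fin n} → p ≢ q → twoδ p q q ≡ 1
twoδʳ {q = q} p≢q = cong₂ _+_ (δF-≢ p≢q) (δ-refl (toℕ q))

twoδ-≢ : ∀ {n} {p q i : Fin n} → i ≢ p → i ≢ q → twoδ p q i ≡ 0
twoδ-≢ i≢p i≢q = cong₂ _+_ (δF-≢ (i≢p ∘ ≡-sym)) (δF-≢ (i≢q ∘ ≡-sym))

even-+2 : ∀ {m k} → m ≡ k + 2 → (∃ λ t → k ≡ t + t) → ∃ λ t → m ≡ t + t
even-+2 refl (t , refl) = suc t ,
  solve 1 (λ s → s :+ s :+ con 2 := con 1 :+ s :+ (con 1 :+ s)) refl t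

even-∸2 : ∀ {m k} → m ≡ k + 2 → (∃ λ t → m ≡ t + t) → ∃ λ t → k ≡ t + t
even-∸2 {k = k} refl (zero , eq) with () ← trans (ℕₚ.+-comm 2 k) eq
even-∸2 {k = k} refl (suc t , eq) = t , ℕₚ.suc-injective (ℕₚ.suc-injective
  (trans (ℕₚ.+-comm 2 k) (trans eq (cong suc (ℕₚ.+-suc t t)))))

degree-sum-even : ∀ {n} (G : Graph n) {f} → HasDegrees G f → ∃ λ t → sum f ≡ t + t
degree-sum-even G degs with deg-sum-even G
... | t , eq = t , trans (≡-sym (sum-cong-≗ degs)) eq

module _ {n} {f : Fin n → ℕ} (sorted : ∀ i j → toℕ i ≤ toℕ j → f j ≤ f i)
         (G : Graph n) (degs : HasDegrees G f) {p q : Fin n} (p≢q : p ≢ q) where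

  forced-top-edge⇒tight : (∀ i j → toℕ i ≤ toℕ j → twoδ p q j ≤ twoδ p q i) →
    (∀ i → i ≢ p → f i ≤ f q) → Forced true f p q → Tight f
  forced-top-edge⇒tight bump-sorted q-second forced with erdős–gallai f⁺ sorted⁺ even⁺
    where
    f⁺ : Fin n → ℕ
    f⁺ i = f i + twoδ p q i
    sorted⁺ : ∀ i j → toℕ i ≤ toℕ j → f⁺ j ≤ f⁺ i
    sorted⁺ i j i≤j = ℕₚ.+-mono-≤ (sorted i j i≤j) (bump-sorted i j i≤j)
    even⁺ : ∃ λ t → sum f⁺ ≡ t + t
    even⁺ = even-+2 (trans (∑-distrib-+ f (twoδ p q)) (cong (sum f +_) (sum-twoδ p q)))
                    (degree-sum-even G degs)
  -- Raising degrees does not lower any cap and adds at most 2 to the total; the strictness of the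
  -- violation turns 2 into 1.
  ... | inj₁ (r , viol) = r , ℕₚ.≤-pred (begin-strict
    sum (cap B f)             ≤⟨ sum-mono (cap-mono B λ i → ℕₚ.m≤m+n (f i) _) ⟩
    sum (cap B f⁺)            <⟨ viol ⟩
    total B f⁺                ≤⟨ total-+ f (twoδ p q) B ⟩
    total B f + sum (twoδ p q) ≡⟨ cong (total B f +_) (sum-twoδ p q) ⟩
    total B f + 2             ≡⟨ ℕₚ.+-comm (total B f) 2 ⟩
    suc (suc (total B f))     ∎)
    where
    open ℕₚ.≤-Reasoning
    f⁺ : Fin n → ℕ
    f⁺ i = f i + twoδ p q i
    B = upto r
  ... | inj₂ (F , degsF) = contradiction-from adjacent
    where
    contradiction-from : (Σ (Graph n) λ F′ → (∀ l → deg F′ l ≡ deg F l) × adj F′ p q ≡ true) → Tight f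
    contradiction-from (F′ , same , pq) =
      true≢false (forced (setEdge F′ p≢q false) back) (setEdge-on F′ p≢q false (inj₁ (refl , refl)))
      where
      back : HasDegrees (setEdge F′ p≢q false) f
      back l = ℕₚ.+-cancelʳ-≡ (twoδ p q l) _ _
        (trans (≡-sym (ℕₚ.+-assoc _ (δF p l) (δF q l))) (trans (removeEdge-deg F′ p≢q pq l)
          (trans (same l) (degsF l))))
    degFp : deg F p ≡ suc (f p)
    degFp = trans (degsF p) (trans (cong (f p +_) (twoδˡ p≢q)) (ℕₚ.+-comm (f p) 1))
    degFq : deg F q ≡ suc (f q)
    degFq = trans (degsF q) (trans (cong (f q +_) (twoδʳ p≢q)) (ℕₚ.+-comm (f q) 1))
    neighbour : ∃ λ x → adj F p x ≡ true
    neighbour with sum-<⇒∃< {f = λ _ → 0} {g = λ j → 𝟙 (adj F p j)}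
                     (subst₂ _<_ (≡-sym (sum-replicate-zero n)) (≡-sym degFp) (s≤s z≤n))
    ... | x , lt = x , proj₂ (𝟙-< {false} lt)
    adjacent : Σ (Graph n) λ F′ → (∀ l → deg F′ l ≡ deg F l) × adj F′ p q ≡ true
    -- If `pq` is absent, a neighbour `x` of `p` was not raised and so has smaller degree than `q`.
    -- Hence `q` has a neighbour `y` not adjacent to `x`, and `px`, `qy` are switched to `pq`, `xy`.
    adjacent with adj F p q Bool.≟ true
    ... | yes pq = F , (λ _ → refl) , pq
    ... | no ¬pq with neighbour
    ...   | x , px = fromSwitch (exchange-< F dx<dq)
      where
      pq = ¬-not ¬pq
      x≢p = adj⇒≢ F (adj-sym F px)
      x≢q : x ≢ q
      x≢q refl = true≢false px pq
      dx<dq : deg F x < deg F q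
      dx<dq = subst₂ _<_ (≡-sym (trans (degsF x) (trans (cong (f x +_) (twoδ-≢ x≢p x≢q)) (ℕₚ.+-identityʳ _))))
                (≡-sym degFq) (s≤s (q-second x x≢p))
      fromSwitch : (∃ λ z → adj F z q ≡ true × adj F z x ≡ false × z ≢ x) → _
      fromSwitch (y , yq , yx , y≢x) with switch F px (adj-sym F yq) pq (adj-sym F yx) p≢q (y≢x ∘ ≡-sym)
      ... | F′ , same , pq′ , _ = F′ , same , pq′

  forced-bottom-nonedge⇒tight : (∀ i → i ≢ p → i ≢ q → toℕ i < toℕ p) → toℕ p < toℕ q → 1 ≤ f q →
    Forced false f p q → Tight f
  forced-bottom-nonedge⇒tight last-two p<q 1≤fq forced = conclude (erdős–gallai f⁻ sorted⁻ even⁻)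
    where
    f⁻ : Fin n → ℕ
    f⁻ i = f i ∸ twoδ p q i
    1≤fp : 1 ≤ f p
    1≤fp = ℕₚ.≤-trans 1≤fq (sorted p q (ℕₚ.<⇒≤ p<q))
    restore : ∀ i → f⁻ i + twoδ p q i ≡ f i
    restore i = ℕₚ.m∸n+n≡m (room i)
      where
      room : ∀ i → twoδ p q i ≤ f i
      room i with i ≟ p | i ≟ q
      ... | yes refl | _ = subst (_≤ f i) (≡-sym (twoδˡ p≢q)) 1≤fp
      ... | no _ | yes refl = subst (_≤ f i) (≡-sym (twoδʳ p≢q)) 1≤fq
      ... | no i≢p | no i≢q = subst (_≤ f i) (≡-sym (twoδ-≢ i≢p i≢q)) z≤n
    at-≢ : ∀ {i} → i ≢ p → i ≢ q → f⁻ i ≡ f i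
    at-≢ {i} i≢p i≢q = cong (f i ∸_) (twoδ-≢ i≢p i≢q)
    at-p : f⁻ p ≡ f p ∸ 1
    at-p = cong (f p ∸_) (twoδˡ p≢q)
    at-q : f⁻ q ≡ f q ∸ 1
    at-q = cong (f q ∸_) (twoδʳ p≢q)
    sorted⁻ : ∀ i j → toℕ i ≤ toℕ j → f⁻ j ≤ f⁻ i
    sorted⁻ i j i≤j with i ≟ p | i ≟ q | j ≟ p | j ≟ q
    ... | no i≢p | no i≢q | _ | _ =
      ℕₚ.≤-trans (ℕₚ.m∸n≤m (f j) (twoδ p q j)) (subst (f j ≤_) (≡-sym (at-≢ i≢p i≢q)) (sorted i j i≤j))
    ... | yes refl | _ | yes refl | _ = ℕₚ.≤-refl
    ... | yes refl | _ | no _ | yes refl =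
      subst₂ _≤_ (≡-sym at-q) (≡-sym at-p) (ℕₚ.∸-monoˡ-≤ 1 (sorted i j i≤j))
    ... | yes refl | _ | no j≢p | no j≢q = contradiction (last-two j j≢p j≢q) (ℕₚ.≤⇒≯ i≤j)
    ... | no _ | yes refl | yes refl | _ = contradiction p<q (ℕₚ.≤⇒≯ i≤j)
    ... | no _ | yes refl | no _ | yes refl = ℕₚ.≤-refl
    ... | no _ | yes refl | no j≢p | no j≢q =
      contradiction (ℕₚ.<-trans (last-two j j≢p j≢q) p<q) (ℕₚ.≤⇒≯ i≤j)
    even⁻ : ∃ λ t → sum f⁻ ≡ t + t
    even⁻ = even-∸2 (trans (≡-sym (sum-cong-≗ restore))
        (trans (∑-distrib-+ f⁻ (twoδ p q)) (cong (sum f⁻ +_) (sum-twoδ p q))))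
      (degree-sum-even G degs)
    conclude : Violation f⁻ ⊎ (Σ (Graph n) λ F → HasDegrees F f⁻) → Tight f
    -- Now the 2 arises on the side of the caps, each of which drops by at most the decrease of its
    -- own degree.
    conclude (inj₁ (r , viol)) = r , ℕₚ.≤-pred (begin-strict
      sum (cap B f)                  ≤⟨ sum-mono (cap-+ B λ i → ℕₚ.≤-reflexive (≡-sym (restore i))) ⟩
      sum (λ j → cap B f⁻ j + twoδ p q j) ≡⟨ ∑-distrib-+ (cap B f⁻) (twoδ p q) ⟩
      sum (cap B f⁻) + sum (twoδ p q) ≡⟨ cong (sum (cap B f⁻) +_) (sum-twoδ p q) ⟩
      sum (cap B f⁻) + 2             <⟨ ℕₚ.+-monoˡ-< 2 viol ⟩
      total B f⁻ + 2                 ≤⟨ ℕₚ.+-monoˡ-≤ 2 (total-mono B λ i → ℕₚ.m∸n≤m (f i) (twoδ p q i)) ⟩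
      total B f + 2                  ≡⟨ ℕₚ.+-comm (total B f) 2 ⟩
      suc (suc (total B f))          ∎)
      where
      open ℕₚ.≤-Reasoning
      B = upto r
    conclude (inj₂ (F , degsF)) = contradiction-from nonadjacent
      where
      contradiction-from : (Σ (Graph n) λ F′ → (∀ l → deg F′ l ≡ deg F l) × adj F′ p q ≡ false) → Tight f
      contradiction-from (F′ , same , pq) =
        true≢false (setEdge-on F′ p≢q true (inj₁ (refl , refl))) (forced (setEdge F′ p≢q true) back)
        where
        back : HasDegrees (setEdge F′ p≢q true) f
        back l = trans (addEdge-deg F′ p≢q pq l) (trans (ℕₚ.+-assoc _ (δF p l) (δF q l))
          (trans (cong (_+ twoδ p q l) (trans (same l) (degsF l))) (restore l)))
      -- The degree of `p` is larger in `G` than in `F`. A non-neighbour taken from an edge of `G`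
      -- is automatically different from `p`.
      non-neighbour : ∃ λ x → adj F p x ≡ false × p ≢ x
      non-neighbour with sum-<⇒∃< {f = λ j → 𝟙 (adj F p j)} {g = λ j → 𝟙 (adj G p j)}
         (subst₂ _<_ (≡-sym (trans (degsF p) at-p)) (≡-sym (degs p)) (ℕₚ.∸-monoʳ-< ℕₚ.≤-refl 1≤fp))
      ... | x , lt with 𝟙-< {adj F p x} lt
      ...   | Fpx , Gpx = x , Fpx , adj⇒≢ G Gpx
      nonadjacent : Σ (Graph n) λ F′ → (∀ l → deg F′ l ≡ deg F l) × adj F′ p q ≡ false
      nonadjacent with adj F p q Bool.≟ false
      ... | yes pq = F , (λ _ → refl) , pq
      ... | no ¬pq with non-neighbour
      ...   | x , px , p≢x = fromSwitch (exchange-< F dq<dx)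
        where
        pq = ¬-not ¬pq
        x≢q : x ≢ q
        x≢q refl = true≢false pq px
        dq<dx : deg F q < deg F x
        dq<dx = subst₂ _<_ (≡-sym (trans (degsF q) at-q))
          (≡-sym (trans (degsF x) (at-≢ (p≢x ∘ ≡-sym) x≢q)))
          (ℕₚ.<-≤-trans (ℕₚ.∸-monoʳ-< ℕₚ.≤-refl 1≤fq)
            (sorted x q (ℕₚ.<⇒≤ (ℕₚ.<-trans (last-two x (p≢x ∘ ≡-sym) x≢q) p<q))))
        fromSwitch : (∃ λ z → adj F z x ≡ true × adj F z q ≡ false × z ≢ q) → _
        fromSwitch (y , yx , yq , y≢q) with switch F pq (adj-sym F yx) px (adj-sym F yq) p≢x (y≢q ∘ ≡-sym)
        ... | F′ , same , _ , pq′ = F′ , same , pq′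

-- Graphs with a tight inequality

-- The absent combinations (A with B, H with H) are the free pairs of a canonical decomposition;
-- repairs toggle only such pairs and the one that is wrong.
data Demands : Role → Role → Bool → Set where
  AA : Demands roleA roleA false
  AH : Demands roleA roleH false
  HA : Demands roleH roleA false
  BB : Demands roleB roleB true
  BH : Demands roleB roleH true
  HB : Demands roleH roleB true

Demands-sym : ∀ {ρ σ b} → Demands ρ σ b → Demands σ ρ b
Demands-sym AA = AA
Demands-sym AH = HA
Demands-sym HA = AH
Demands-sym BB = BB
Demands-sym BH = HB
Demands-sym HB = BH

FitsAt : ∀ {n} → Graph n → (Fin n → Role) → Fin n → Fin n → Set
FitsAt G ρ u v = ∀ {b} → Demands (ρ u) (ρ v) b → adj G u v ≡ b

FitsAt-sym : ∀ {n} (G : Graph n) {ρ : Fin n → Role} {u v} → FitsAt G ρ u v → FitsAt G ρ v u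
FitsAt-sym G fits d = adj-sym G (fits (Demands-sym d))

Fits : ∀ {n} → Graph n → (Fin n → Role) → Set
Fits G ρ = ∀ u v → u ≢ v → FitsAt G ρ u v

fits⇒canDec : ∀ {n} (G : Graph n) {ρ : Fin n → Role} {b h} → Fits G ρ →
  ρ b ≡ roleB → ρ h ≡ roleH → IsCanDecGraph G
fits⇒canDec G {ρ} {b} {h} fits ρb ρh = ρ , (b , inj₂ ρb) , (h , ρh)
  , (λ u v ρu ρv → independent u v (subst₂ (λ a c → Demands a c false) (≡-sym ρu) (≡-sym ρv) AA))
  , (λ u v ρu ρv u≢v → fits u v u≢v (subst₂ (λ a c → Demands a c true) (≡-sym ρu) (≡-sym ρv) BB))
  , (λ u v ρu ρv → fits u v (λ { refl → clash ρu ρv (λ ()) })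
       (subst₂ (λ a c → Demands a c true) (≡-sym ρu) (≡-sym ρv) BH))
  , (λ u v ρu ρv → fits u v (λ { refl → clash ρu ρv (λ ()) })
       (subst₂ (λ a c → Demands a c false) (≡-sym ρu) (≡-sym ρv) AH))
  where
  clash : ∀ {u σ τ} → ρ u ≡ σ → ρ u ≡ τ → σ ≢ τ → ∀ {X : Set} → X
  clash p q σ≢τ = contradiction (trans (≡-sym p) q) σ≢τ
  independent : ∀ u v → Demands (ρ u) (ρ v) false → adj G u v ≡ false
  independent u v d with u ≟ v
  ... | yes refl = irrefl G u
  ... | no u≢v   = fits u v u≢v d

move-fits : ∀ {n} {G : Graph n} {ρ : Fin n → Role} {z x y} (M : Move G z x y) →
  (∀ u v → u ≢ v → ¬ Pair z x u v → ¬ Pair z y u v → FitsAt G ρ u v) →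
  (∀ {b} → Demands (ρ z) (ρ x) b → b ≡ false) →
  (∀ {b} → Demands (ρ z) (ρ y) b → b ≡ true) → Fits (Move.graph M) ρ
move-fits {G = G} {ρ} {z} {x} {y} M elsewhere zx zy u v u≢v with pair? z x u v | pair? z y u v
... | yes (inj₁ (refl , refl)) | _ = λ d → trans (Move.adj-old M) (≡-sym (zx d))
... | yes (inj₂ (refl , refl)) | _ =
  FitsAt-sym (Move.graph M) {ρ} {z} {x} λ d → trans (Move.adj-old M) (≡-sym (zx d))
... | no _ | yes (inj₁ (refl , refl)) = λ d → trans (Move.adj-new M) (≡-sym (zy d))
... | no _ | yes (inj₂ (refl , refl)) =
  FitsAt-sym (Move.graph M) {ρ} {z} {y} λ d → trans (Move.adj-new M) (≡-sym (zy d))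
... | no ¬zx | no ¬zy = λ d → trans (Move.adj-off M ¬zx ¬zy) (elsewhere u v u≢v ¬zx ¬zy d)

-- Some `z` is adjacent to `x` but not to `y`. As `x` and `y` have equal roles, a demand on one of
-- these pairs would be a demand on both, and they disagree; so neither is constrained and the edge
-- may be moved.
fits-shift : ∀ {n} (G : Graph n) {ρ : Fin n → Role} {x y} → Fits G ρ → ρ x ≡ ρ y → deg G y < deg G x →
  Σ (Graph n) λ G′ → Fits G′ ρ × (∀ l → deg G′ l + δF x l ≡ deg G l + δF y l)
fits-shift G {ρ} {x} {y} fits ρx≡ρy dy<dx with exchange-< G dy<dx
... | z , zx , zy , z≢y = Move.graph m ,
  move-fits m (λ u v u≢v _ _ → fits u v u≢v)
    (λ {b} d → trans (≡-sym (fits z y z≢y (subst (λ τ → Demands (ρ z) τ b) ρx≡ρy d))) zy)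
    (λ {b} d → trans (≡-sym (fits z x (adj⇒≢ G zx) (subst (λ τ → Demands (ρ z) τ b) (≡-sym ρx≡ρy) d))) zx) ,
  Move.deg-eq m
  where m = move G zx zy z≢y

-- Roles read off from the caps, and the repair of one defect

module Structure {n} {f : Fin n → ℕ} (G : Graph n) (degs : HasDegrees G f) (B : Fin n → Bool) where

  K : ℕ
  K = size B

  abstract
    -- Outside `B` the role records which term of the minimum in `cap` is attained. If it is `K`,
    -- reaching the cap means being joined to all of `B`; if it is `f j`, it means having no
    -- neighbour outside `B`.
    role : Fin n → Role
    role j = if B j then roleB else if does (K ≤? f j) then roleH else roleA

    role-B : ∀ {j} → B j ≡ true → role j ≡ roleB
    role-B Bj rewrite Bj = refl

    role-H : ∀ {j} → B j ≡ false → K ≤ f j → role j ≡ roleH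
    role-H {j} Bj K≤ rewrite Bj | dec-true (K ≤? f j) K≤ = refl

    role-A : ∀ {j} → B j ≡ false → f j < K → role j ≡ roleA
    role-A {j} Bj <K rewrite Bj | dec-false (K ≤? f j) (ℕₚ.<⇒≱ <K) = refl

  data View (j : Fin n) : Role → Set where
    inB : B j ≡ true → View j roleB
    inH : B j ≡ false → K ≤ f j → View j roleH
    inA : B j ≡ false → f j < K → View j roleA

  view : ∀ j → View j (role j)
  view j with B j in Bj
  ... | true = subst (View j) (≡-sym (role-B Bj)) (inB Bj)
  ... | false with K ≤? f j
  ...   | yes K≤ = subst (View j) (≡-sym (role-H Bj K≤)) (inH Bj K≤)
  ...   | no K≰ = subst (View j) (≡-sym (role-A Bj (ℕₚ.≰⇒> K≰))) (inA Bj (ℕₚ.≰⇒> K≰))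

  Full : Fin n → Set
  Full j = into G B j ≡ cap B f j

  cap-B : ∀ {j} → B j ≡ true → cap B f j ≡ ℕ.pred K
  cap-B Bj rewrite Bj = refl

  cap-H : ∀ {j} → B j ≡ false → K ≤ f j → cap B f j ≡ K
  cap-H Bj K≤ rewrite Bj = ℕₚ.m≤n⇒m⊓n≡m K≤

  cap-A : ∀ {j} → B j ≡ false → f j < K → cap B f j ≡ f j
  cap-A Bj <K rewrite Bj = ℕₚ.m≥n⇒m⊓n≡n (ℕₚ.<⇒≤ <K)

  pred<K : ∀ {j} → B j ≡ true → suc (ℕ.pred K) ≡ K
  pred<K {j} Bj = ℕₚ.suc-pred K {{ℕ.>-nonZero (ℕₚ.≤-<-trans z≤n (into<size G B j Bj))}}

  joined-to-clique : ∀ {i j} → Full j → B j ≡ true → B i ≡ true → i ≢ j → adj G i j ≡ true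
  joined-to-clique {i} {j} full Bj Bi i≢j with adj G i j | sum-mono-≡ (into-self-≤ G B j Bj)
    (ℕₚ.≤-reflexive (≡-sym (trans (sum-+δF (λ i → 𝟙 (B i ∧ adj G i j)) j)
      (trans (cong suc (trans full (cap-B Bj))) (pred<K Bj))))) i
  ... | true  | _ = refl
  ... | false | eq rewrite Bi | δF-≢ (i≢j ∘ ≡-sym) with () ← eq

  joined-to-H : ∀ {i j} → Full j → B j ≡ false → K ≤ f j → B i ≡ true → adj G i j ≡ true
  joined-to-H {i} {j} full Bj K≤ Bi with adj G i j | sum-mono-≡ (λ i → 𝟙-∧≤ˡ (B i) (adj G i j))
    (ℕₚ.≤-reflexive (≡-sym (trans full (cap-H Bj K≤)))) i
  ... | true  | _ = refl
  ... | false | eq rewrite Bi with () ← eq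

  into-≤ : ∀ j i → 𝟙 (B i ∧ adj G i j) ≤ 𝟙 (adj G j i)
  into-≤ j i = subst (λ b → 𝟙 (B i ∧ adj G i j) ≤ 𝟙 b) (Graph.sym G i j) (𝟙-∧≤ʳ (B i) _)

  apart-from-A : ∀ {i j} → Full j → B j ≡ false → f j < K → B i ≡ false → adj G j i ≡ false
  apart-from-A {i} {j} full Bj <K Bi with adj G j i | sum-mono-≡ (into-≤ j)
    (ℕₚ.≤-reflexive (≡-sym (trans full (trans (cap-A Bj <K) (≡-sym (degs j)))))) i
  ... | false | _ = refl
  ... | true  | eq rewrite Bi with () ← eq

  full-fits : ∀ {u v} → Full u → Full v → u ≢ v → FitsAt G role u v
  full-fits {u} {v} fu fv u≢v d with role u | view u | role v | view v | d
  ... | _ | inA Bu <u | _ | inA Bv <v | AA = apart-from-A fu Bu <u Bv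
  ... | _ | inA Bu <u | _ | inH Bv ≤v | AH = apart-from-A fu Bu <u Bv
  ... | _ | inH Bu ≤u | _ | inA Bv <v | HA = adj-sym G (apart-from-A fv Bv <v Bu)
  ... | _ | inB Bu    | _ | inB Bv    | BB = joined-to-clique fv Bv Bu u≢v
  ... | _ | inB Bu    | _ | inH Bv ≤v | BH = joined-to-H fv Bv ≤v Bu
  ... | _ | inH Bu ≤u | _ | inB Bv    | HB = adj-sym G (joined-to-H fu Bu ≤u Bv)

  all-full : (∀ j → Full j) → ∃ (λ b → B b ≡ true) → IsSplitGraph G ⊎ IsCanDecGraph G
  all-full full (b , Bb) with any? (λ h → B h Bool.≟ false ×-dec K ≤? f h)
  ... | yes (h , Bh , K≤) = inj₂ (fits⇒canDec G (λ u v → full-fits (full u) (full v)) (role-B Bb) (role-H Bh K≤))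
  ... | no none = inj₁ (B
      , (λ u v Bu Bv → apart-from-A (full u) Bu (ℕₚ.≰⇒> λ K≤ → none (u , Bu , K≤)) Bv)
      , (λ u v Bu Bv → joined-to-clique (full v) Bv Bu))

  -- A single unit of slack, repaired by moving one edge end from y to b.
  record Repair : Set where
    field
      graph  : Graph n
      fits   : Fits graph role
      b y    : Fin n
      b∈B    : B b ≡ true
      y∉B    : B y ≡ false
      K<fy   : K < f y
      deg-eq : ∀ l → deg graph l + δF y l ≡ f l + δF b l

  module Defect (j : Fin n) (slack : suc (into G B j) ≡ cap B f j) (full : ∀ i → i ≢ j → Full i) where

    -- An edge missing inside `B` is missing at both of its ends, so it would produce a second
    -- defective vertex.
    j∉B : B j ≡ false
    j∉B = ¬-not λ Bj → absurd Bj (sum-<⇒∃< (subst (_< K)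
        (≡-sym (trans (sum-+δF (λ i → 𝟙 (B i ∧ adj G i j)) j) (trans slack (cap-B Bj))))
        (ℕₚ.≤-reflexive (pred<K Bj))))
      where
      absurd : B j ≡ true → ¬ (∃ λ i → 𝟙 (B i ∧ adj G i j) + δF j i < 𝟙 (B i))
      absurd Bj (i , lt) with B i in Bi | j ≟ i
      ... | false | _ = contradiction lt λ ()
      ... | true | yes refl rewrite δ-refl (toℕ j) = ℕₚ.<⇒≱ lt (ℕₚ.m≤n+m 1 _)
      ... | true | no j≢i rewrite adj-sym G (joined-to-clique (full i (j≢i ∘ ≡-sym)) Bi Bj j≢i) = ℕₚ.<⇒≱ lt (s≤s z≤n)

    -- A full vertex of role A has no neighbour outside `B`, so `y` has role H; it sees all `K`
    -- vertices of `B` and in addition `j`.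
    outside-nbr-large : ∀ {y} → B y ≡ false → adj G y j ≡ true → K < f y
    outside-nbr-large {y} By yj with K ≤? f y
    ... | no K≰ = true≢false yj (apart-from-A (full y (adj⇒≢ G yj)) By (ℕₚ.≰⇒> K≰) j∉B)
    ... | yes K≤ = subst₂ _<_ (trans (full y (adj⇒≢ G yj)) (cap-H By K≤)) (degs y)
                     (sum-mono-< (into-≤ y) j at-j)
      where
      at-j : 𝟙 (B j ∧ adj G j y) < 𝟙 (adj G y j)
      at-j rewrite j∉B | yj = s≤s z≤n

    elsewhere : ∀ t → (∀ v → v ≢ t → v ≢ j → FitsAt G role j v) →
      ∀ u v → u ≢ v → ¬ Pair j t u v → FitsAt G role u v
    elsewhere t at-j u v u≢v ¬jt with u ≟ j | v ≟ j
    ... | yes refl | _ = at-j v (λ { refl → ¬jt (inj₁ (refl , refl)) }) (u≢v ∘ ≡-sym)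
    ... | no u≢j | yes refl = FitsAt-sym G {role} {v} {u} (at-j u (λ { refl → ¬jt (inj₂ (refl , refl)) }) u≢v)
    ... | no u≢j | no v≢j = full-fits (full u u≢j) (full v v≢j) u≢v

    demands-HH : ∀ {σ τ b c} → σ ≡ roleH → τ ≡ roleH → Demands σ τ b → b ≡ c
    demands-HH refl refl ()

    demands-AB : ∀ {σ τ b c} → σ ≡ roleA → τ ≡ roleB → Demands σ τ b → b ≡ c
    demands-AB refl refl ()

    demands-B : ∀ {σ τ b} → τ ≡ roleB → Demands σ τ b → b ≡ true
    demands-B refl BB = refl
    demands-B refl HB = refl

    demands-A : ∀ {σ τ b} → σ ≡ roleA → Demands σ τ b → b ≡ false
    demands-A refl AA = refl
    demands-A refl AH = refl

    -- Here `j` misses exactly one `b` in `B`, and its degree forces a neighbour `y` outside. Both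
    -- `j` and `y` have role H, so `jy` is free and can be exchanged for `jb`.
    repair-H : K ≤ f j → Repair
    repair-H K≤ with missing-in G B j into<K
                   | nbr-outside G B j (ℕₚ.<-≤-trans into<K (subst (K ≤_) (≡-sym (degs j)) K≤))
      where
      into<K : into G B j < K
      into<K = ℕₚ.≤-reflexive (trans slack (cap-H j∉B K≤))
    ... | b , Bb , bj | y , By , yj = record
      { graph = Move.graph m
      ; fits = move-fits m
          (λ u v u≢v _ ¬jb → elsewhere b at-j u v u≢v ¬jb)
          (demands-HH (role-H j∉B K≤) (role-H By (ℕₚ.<⇒≤ (outside-nbr-large By yj))))
          (demands-B (role-B Bb))
      ; b = b ; y = y ; b∈B = Bb ; y∉B = By
      ; K<fy = outside-nbr-large By yj
      ; deg-eq = λ l → trans (Move.deg-eq m l) (cong (_+ δF b l) (degs l))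
      }
      where
      j≢b : j ≢ b
      j≢b refl = true≢false Bb j∉B
      m = move G (adj-sym G yj) (adj-sym G bj) j≢b
      others : ∀ v → B v ≡ true → v ≢ b → adj G v j ≡ true
      others v Bv v≢b with adj G v j | sum-mono-≡ pointwise (ℕₚ.≤-reflexive (≡-sym
            (trans (sum-+δF (λ i → 𝟙 (B i ∧ adj G i j)) b) (trans slack (cap-H j∉B K≤))))) v
        where
        pointwise : ∀ i → 𝟙 (B i ∧ adj G i j) + δF b i ≤ 𝟙 (B i)
        pointwise i with b ≟ i
        ... | yes refl rewrite Bb | bj | δ-refl (toℕ b) = ℕₚ.≤-refl
        ... | no b≢i rewrite δF-≢ b≢i = subst (_≤ 𝟙 (B i)) (≡-sym (ℕₚ.+-identityʳ _)) (𝟙-∧≤ˡ (B i) _)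
      ... | true  | _ = refl
      ... | false | eq rewrite Bv | δF-≢ (v≢b ∘ ≡-sym) with () ← eq
      at-j : ∀ v → v ≢ b → v ≢ j → FitsAt G role j v
      at-j v v≢b v≢j d with role j | role-H j∉B K≤ | role v | view v | d
      ... | _ | refl | _ | inA Bv <v | HA = adj-sym G (apart-from-A (full v v≢j) Bv <v j∉B)
      ... | _ | refl | _ | inB Bv | HB = adj-sym G (others v Bv v≢b)

    -- Here the fault is the single neighbour `c` of `j` outside `B`. As `j` has fewer than `K`
    -- neighbours, some `b` in `B` is not among them, and `jb` is free as a pair of roles A and B.
    repair-A : f j < K → Repair
    repair-A <K with missing-in G B j (ℕₚ.<-trans into<f <K)
                   | nbr-outside G B j (subst (into G B j <_) (≡-sym (degs j)) into<f)
      where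
      into<f : into G B j < f j
      into<f = ℕₚ.≤-reflexive (trans slack (cap-A j∉B <K))
    ... | b , Bb , bj | c , Bc , cj = record
      { graph = Move.graph m
      ; fits = move-fits m
          (λ u v u≢v ¬jc _ → elsewhere c at-j u v u≢v ¬jc)
          (demands-A (role-A j∉B <K))
          (demands-AB (role-A j∉B <K) (role-B Bb))
      ; b = b ; y = c ; b∈B = Bb ; y∉B = Bc
      ; K<fy = outside-nbr-large Bc cj
      ; deg-eq = λ l → trans (Move.deg-eq m l) (cong (_+ δF b l) (degs l))
      }
      where
      j≢b : j ≢ b
      j≢b refl = true≢false Bb j∉B
      m = move G (adj-sym G cj) (adj-sym G bj) j≢b
      others : ∀ v → B v ≡ false → v ≢ c → adj G j v ≡ false
      others v Bv v≢c with adj G j v | sum-mono-≡ pointwise (ℕₚ.≤-reflexive (≡-sym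
            (trans (sum-+δF (λ i → 𝟙 (B i ∧ adj G i j)) c) (trans slack (trans (cap-A j∉B <K) (≡-sym (degs j))))))) v
        where
        pointwise : ∀ i → 𝟙 (B i ∧ adj G i j) + δF c i ≤ 𝟙 (adj G j i)
        pointwise i with c ≟ i
        ... | yes refl rewrite Bc | adj-sym G cj | δ-refl (toℕ c) = ℕₚ.≤-refl
        ... | no c≢i rewrite δF-≢ c≢i = subst (_≤ 𝟙 (adj G j i)) (≡-sym (ℕₚ.+-identityʳ _)) (into-≤ j i)
      ... | false | _ = refl
      ... | true | eq rewrite Bv | δF-≢ (v≢c ∘ ≡-sym) with () ← eq
      at-j : ∀ v → v ≢ c → v ≢ j → FitsAt G role j v
      at-j v v≢c v≢j d with role j | role-A j∉B <K | role v | view v | d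
      ... | _ | refl | _ | inA Bv _ | AA = others v Bv v≢c
      ... | _ | refl | _ | inH Bv _ | AH = others v Bv v≢c

    repair : Repair
    repair with K ≤? f j
    ... | yes K≤ = repair-H K≤
    ... | no K≰  = repair-A (ℕₚ.≰⇒> K≰)

  module _ (R : Repair) where
    open Repair R

    -- In the repaired graph `b` has degree `f b` + 1, more than `i` has, so `fits-shift` hands the
    -- extra unit to `i`.
    replace-b : ∀ i → B i ≡ true → f i ≤ f b →
      Σ (Graph n) λ G′ → Fits G′ role × (∀ l → deg G′ l + δF y l ≡ f l + δF i l)
    replace-b i Bi fi≤fb with i ≟ b
    ... | yes refl = graph , fits , deg-eq
    ... | no i≢b with fits-shift graph fits (trans (role-B b∈B) (≡-sym (role-B Bi))) di<db
      where
      b≢y : b ≢ y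
      b≢y refl = true≢false b∈B y∉B
      i≢y : i ≢ y
      i≢y refl = true≢false Bi y∉B
      db : deg graph b ≡ suc (f b)
      db = trans (≡-sym (ℕₚ.+-identityʳ _)) (trans (subst₂ (λ p q → deg graph b + p ≡ f b + q)
             (δF-≢ (b≢y ∘ ≡-sym)) (δ-refl (toℕ b)) (deg-eq b)) (ℕₚ.+-comm (f b) 1))
      di : deg graph i ≡ f i
      di = trans (≡-sym (ℕₚ.+-identityʳ _)) (trans (subst₂ (λ p q → deg graph i + p ≡ f i + q)
             (δF-≢ (i≢y ∘ ≡-sym)) (δF-≢ (i≢b ∘ ≡-sym)) (deg-eq i)) (ℕₚ.+-identityʳ _))
      di<db : deg graph i < deg graph b
      di<db = subst₂ _<_ (≡-sym di) (≡-sym db) (s≤s fi≤fb)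
    ...   | G′ , fits′ , eqs = G′ , fits′ , λ l → ℕₚ.+-cancelʳ-≡ (δF b l) _ _ (begin
      deg G′ l + δF y l + δF b l  ≡⟨ swapʳ (deg G′ l) (δF y l) (δF b l) ⟩
      deg G′ l + δF b l + δF y l  ≡⟨ cong (_+ δF y l) (eqs l) ⟩
      deg graph l + δF i l + δF y l ≡⟨ swapʳ (deg graph l) (δF i l) (δF y l) ⟩
      deg graph l + δF y l + δF i l ≡⟨ cong (_+ δF i l) (deg-eq l) ⟩
      f l + δF b l + δF i l       ≡⟨ swapʳ (f l) (δF b l) (δF i l) ⟩
      f l + δF i l + δF b l       ∎)
      where
      open ≡-Reasoning
      swapʳ : ∀ p q r → p + q + r ≡ p + r + q
      swapʳ = solve 3 (λ p q r → p :+ q :+ r := p :+ r :+ q) refl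

    -- Symmetrically, `y` has lost a unit and so has smaller degree than `j`; both have role H
    -- because `K < f y ≤ f j`. The same `j` shows that the H part is nonempty.
    replace-both : ∀ i j → B i ≡ true → f i ≤ f b → B j ≡ false → f y ≤ f j →
      Σ (Graph n) λ G′ → IsCanDecGraph G′ × (∀ l → deg G′ l + δF j l ≡ f l + δF i l)
    replace-both i j Bi fi≤fb Bj fy≤fj with replace-b i Bi fi≤fb
    ... | G₁ , fits₁ , eqs₁ with j ≟ y
    ...   | yes refl = G₁ , fits⇒canDec G₁ fits₁ (role-B Bi) (role-H Bj (ℕₚ.<⇒≤ K<fy)) , eqs₁
    ...   | no j≢y = finish (fits-shift G₁ fits₁ (trans role-j (≡-sym (role-H y∉B (ℕₚ.<⇒≤ K<fy)))) dy<dj)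
      where
      role-j = role-H Bj (ℕₚ.≤-trans (ℕₚ.<⇒≤ K<fy) fy≤fj)
      i≢j : i ≢ j
      i≢j refl = true≢false Bi Bj
      i≢y : i ≢ y
      i≢y refl = true≢false Bi y∉B
      dj : deg G₁ j ≡ f j
      dj = trans (≡-sym (ℕₚ.+-identityʳ _)) (trans (subst₂ (λ p q → deg G₁ j + p ≡ f j + q)
             (δF-≢ (j≢y ∘ ≡-sym)) (δF-≢ i≢j) (eqs₁ j)) (ℕₚ.+-identityʳ _))
      dy : suc (deg G₁ y) ≡ f y
      dy = trans (ℕₚ.+-comm 1 _) (trans (subst₂ (λ p q → deg G₁ y + p ≡ f y + q)
             (δ-refl (toℕ y)) (δF-≢ i≢y) (eqs₁ y)) (ℕₚ.+-identityʳ _))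
      dy<dj : deg G₁ y < deg G₁ j
      dy<dj = subst₂ _≤_ (≡-sym dy) (≡-sym dj) fy≤fj
      finish : _ → _
      finish (G₂ , fits₂ , eqs₂) =
        G₂ , fits⇒canDec G₂ fits₂ (role-B Bi) role-j , λ l → trans (eqs₂ l) (eqs₁ l)

-- The freedom in i and j is used to make the target reachable by few covering steps.
Liftable : ∀ {n} → (Fin n → ℕ) → Set
Liftable {n} f = Σ (Fin n) λ r → Σ (Fin n) λ y → toℕ r < toℕ y × 1 ≤ f y ×
  (∀ i j → toℕ i ≤ toℕ r → f i ≤ f r → toℕ r < toℕ j → f y ≤ f j →
    Σ (Graph n) λ G′ → IsCanDecGraph G′ × (∀ l → deg G′ l + δF j l ≡ f l + δF i l))

tight⇒structure : ∀ {n} {f : Fin n → ℕ} → (∀ i j → toℕ i ≤ toℕ j → f j ≤ f i) →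
  (G : Graph n) → HasDegrees G f → Tight f → (IsSplitGraph G ⊎ IsCanDecGraph G) ⊎ Liftable f
tight⇒structure {f = f} sorted G degs (r , tight)
  with sum-≤-suc into≤ (subst (sum (cap B f) ≤_) (cong suc total≡) tight)
  where
  B = upto r
  into≤ : ∀ j → into G B j ≤ cap B f j
  into≤ j = ℕₚ.≤-trans (into≤cap G B j) (cap-mono B (λ i → ℕₚ.≤-reflexive (degs i)) j)
  total≡ : total B f ≡ sum (into G B)
  total≡ = trans (≡-sym (ℕₚ.≤-antisym (total-mono B λ i → ℕₚ.≤-reflexive (degs i))
                                      (total-mono B λ i → ℕₚ.≤-reflexive (≡-sym (degs i)))))
                 (total-deg G B)
... | inj₁ full = inj₁ (Structure.all-full G degs (upto r) full (r , upto-≤ {r = r} {r} ℕₚ.≤-refl))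
... | inj₂ (j , slack , full) = inj₂ (r , y , upto-false {r = r} y∉B , ℕₚ.≤-<-trans z≤n K<fy ,
      λ i j i≤r fi≤fr r<j fy≤fj → replace-both repaired i j (upto-≤ {r = r} i≤r)
        (ℕₚ.≤-trans fi≤fr (sorted b r (upto-true {r = r} b∈B))) (upto-> {r = r} r<j) fy≤fj)
  where
  open Structure G degs (upto r)
  repaired = Defect.repair j slack full
  open Repair repaired

-- Covering in the dominance order

-- The value 0 past the end makes r + 1 and similar positions legal without bounds and keeps
-- nonincreasing sequences nonincreasing.
at : ∀ {n} → Vec ℕ n → ℕ → ℕ
at []       _       = 0
at (x ∷ xs) zero    = x
at (x ∷ xs) (suc t) = at xs t

at-toℕ : ∀ {n} (a : Vec ℕ n) i → at a (toℕ i) ≡ lookup a i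
at-toℕ (x ∷ xs) zero    = refl
at-toℕ (x ∷ xs) (suc i) = at-toℕ xs i

at-≥ : ∀ {n} (a : Vec ℕ n) {t} → n ≤ t → at a t ≡ 0
at-≥ []       _         = refl
at-≥ (x ∷ xs) (s≤s n≤t) = at-≥ xs n≤t

at-positive : ∀ {n} (a : Vec ℕ n) {t} → 0 < at a t → t < n
at-positive a lt = ℕₚ.≰⇒> λ n≤t → contradiction (subst (0 <_) (at-≥ a n≤t) lt) λ ()

at-ext : ∀ {n} {a b : Vec ℕ n} → (∀ t → at a t ≡ at b t) → a ≡ b
at-ext {a = []}    {[]}    _  = refl
at-ext {a = _ ∷ _} {_ ∷ _} eq = cong₂ _∷_ (eq 0) (at-ext (eq ∘ suc))

fromAt : ∀ n → (ℕ → ℕ) → Vec ℕ n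
fromAt zero    h = []
fromAt (suc n) h = h 0 ∷ fromAt n (h ∘ suc)

at-fromAt : ∀ {n} h {t} → t < n → at (fromAt n h) t ≡ h t
at-fromAt {suc n} h {zero}  _         = refl
at-fromAt {suc n} h {suc t} (s≤s t<n) = at-fromAt (h ∘ suc) t<n

prefix-suc : ∀ {n} t (a : Vec ℕ n) → prefix (suc t) a ≡ prefix t a + at a t
prefix-suc zero    []       = refl
prefix-suc (suc t) []       = refl
prefix-suc zero    (x ∷ xs) = ℕₚ.+-identityʳ x
prefix-suc (suc t) (x ∷ xs) =
  trans (cong (x +_) (prefix-suc t xs)) (≡-sym (ℕₚ.+-assoc x (prefix t xs) (at xs t)))

sum-prefix : ∀ {n} (a : Vec ℕ n) → Vec.sum a ≡ prefix n a
sum-prefix []       = refl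
sum-prefix (x ∷ xs) = cong (x +_) (sum-prefix xs)

prefix-ext : ∀ {n} {a b : Vec ℕ n} → (∀ t → prefix t a ≡ prefix t b) → a ≡ b
prefix-ext {a = a} {b} eq = at-ext λ t → ℕₚ.+-cancelˡ-≡ (prefix t a) _ _
  (trans (≡-sym (prefix-suc t a)) (trans (eq (suc t))
    (trans (prefix-suc t b) (cong (_+ at b t) (≡-sym (eq t))))))

Antitone : ∀ {n} → Vec ℕ n → Set
Antitone a = ∀ s t → s ≤ t → at a t ≤ at a s

nonincreasing⇒antitone : ∀ {n} (a : Vec ℕ n) → Nonincreasing a → Antitone a
nonincreasing⇒antitone {n} a ni s t s≤t with t ℕ.<? n
... | no t≮n = subst (_≤ at a s) (≡-sym (at-≥ a (ℕₚ.≮⇒≥ t≮n))) z≤n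
... | yes t<n = subst₂ _≤_ (at-fromℕ< t<n) (at-fromℕ< s<n)
      (ni (fromℕ< s<n) (fromℕ< t<n) (subst₂ _≤_ (≡-sym (toℕ-fromℕ< s<n)) (≡-sym (toℕ-fromℕ< t<n)) s≤t))
  where
  s<n = ℕₚ.≤-<-trans s≤t t<n
  at-fromℕ< : ∀ {k} (k<n : k < n) → lookup a (fromℕ< k<n) ≡ at a k
  at-fromℕ< k<n = trans (≡-sym (at-toℕ a _)) (cong (at a) (toℕ-fromℕ< k<n))

antitone⇒nonincreasing : ∀ {n} (a : Vec ℕ n) → Antitone a → Nonincreasing a
antitone⇒nonincreasing a anti i j i≤j = subst₂ _≤_ (at-toℕ a j) (at-toℕ a i) (anti (toℕ i) (toℕ j) i≤j)

-- The indicator of `i < t`, that is, the prefix sum of `δ i`.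
before : ℕ → ℕ → ℕ
before _       zero    = 0
before zero    (suc _) = 1
before (suc i) (suc t) = before i t

before-suc : ∀ i t → before i (suc t) ≡ before i t + δ i t
before-suc zero    zero    = refl
before-suc zero    (suc t) = refl
before-suc (suc i) zero    = refl
before-suc (suc i) (suc t) = before-suc i t

before-< : ∀ {i t} → i < t → before i t ≡ 1
before-< {zero}  (s≤s _)   = refl
before-< {suc i} (s≤s i<t) = before-< i<t

before-≥ : ∀ {i t} → t ≤ i → before i t ≡ 0
before-≥ {t = zero} _         = refl
before-≥            (s≤s t≤i) = before-≥ t≤i

Transfer : ∀ {n} → ℕ → ℕ → Vec ℕ n → Vec ℕ n → Set
Transfer i j a b = ∀ t → at b t + δ j t ≡ at a t + δ i t

-- The conditions under which raising entry `i`, or lowering entry `j`, keeps the order. Entries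
-- past the end read 0, so at the last index `Down` says that the entry is positive.
Up Down : ∀ {n} → Vec ℕ n → ℕ → Set
Up   a i = ∀ l → l < i → at a i < at a l
Down a j = ∀ l → j < l → at a l < at a j

module Transferred {n} {a b : Vec ℕ n} {i j} (i<j : i < j) (T : Transfer i j a b) where

  i≢j = ℕₚ.<⇒≢ i<j

  at-i : at b i ≡ suc (at a i)
  at-i = trans (≡-sym (ℕₚ.+-identityʳ _)) (trans (subst₂ (λ p q → at b i + p ≡ at a i + q)
    (δ-≢ (i≢j ∘ ≡-sym)) (δ-refl i) (T i)) (ℕₚ.+-comm _ 1))

  at-j : suc (at b j) ≡ at a j
  at-j = trans (ℕₚ.+-comm 1 _) (trans (subst₂ (λ p q → at b j + p ≡ at a j + q)
    (δ-refl j) (δ-≢ i≢j) (T j)) (ℕₚ.+-identityʳ _))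

  at-≤ : ∀ {t} → t ≢ i → at b t ≤ at a t
  at-≤ {t} t≢i = ℕₚ.≤-trans (ℕₚ.m≤m+n _ (δ j t)) (ℕₚ.≤-reflexive (trans (T t)
    (trans (cong (at a t +_) (δ-≢ (t≢i ∘ ≡-sym))) (ℕₚ.+-identityʳ _))))

  at-≥′ : ∀ {t} → t ≢ j → at a t ≤ at b t
  at-≥′ {t} t≢j = ℕₚ.≤-trans (ℕₚ.m≤m+n _ (δ i t)) (ℕₚ.≤-reflexive (trans (≡-sym (T t))
    (trans (cong (at b t +_) (δ-≢ (t≢j ∘ ≡-sym))) (ℕₚ.+-identityʳ _))))

  at-≡ : ∀ {t} → t ≢ i → t ≢ j → at b t ≡ at a t
  at-≡ t≢i t≢j = ℕₚ.≤-antisym (at-≤ t≢i) (at-≥′ t≢j)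

  prefix-eq : ∀ t → prefix t b + before j t ≡ prefix t a + before i t
  prefix-eq zero    = refl
  prefix-eq (suc t) = begin
    prefix (suc t) b + before j (suc t)
      ≡⟨ cong₂ _+_ (prefix-suc t b) (before-suc j t) ⟩
    prefix t b + at b t + (before j t + δ j t)
      ≡⟨ interchange (prefix t b) (at b t) (before j t) (δ j t) ⟩
    prefix t b + before j t + (at b t + δ j t)
      ≡⟨ cong₂ _+_ (prefix-eq t) (T t) ⟩
    prefix t a + before i t + (at a t + δ i t)
      ≡⟨ interchange (prefix t a) (before i t) (at a t) (δ i t) ⟩
    prefix t a + at a t + (before i t + δ i t)
      ≡⟨ cong₂ _+_ (prefix-suc t a) (before-suc i t) ⟨
    prefix (suc t) a + before i (suc t) ∎
    where
    open ≡-Reasoning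
    interchange : ∀ p q r s → p + q + (r + s) ≡ p + r + (q + s)
    interchange = solve 4 (λ p q r s → p :+ q :+ (r :+ s) := p :+ r :+ (q :+ s)) refl

  prefix-before : ∀ {t} → t ≤ i → prefix t b ≡ prefix t a
  prefix-before {t} t≤i = ℕₚ.+-cancelʳ-≡ 0 _ _ (subst₂ (λ p q → prefix t b + p ≡ prefix t a + q)
    (before-≥ (ℕₚ.≤-trans t≤i (ℕₚ.<⇒≤ i<j))) (before-≥ t≤i) (prefix-eq t))

  prefix-after : ∀ {t} → j < t → prefix t b ≡ prefix t a
  prefix-after {t} j<t = ℕₚ.+-cancelʳ-≡ 1 _ _ (subst₂ (λ p q → prefix t b + p ≡ prefix t a + q)
    (before-< j<t) (before-< (ℕₚ.<-trans i<j j<t)) (prefix-eq t))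

  prefix-between : ∀ {t} → i < t → t ≤ j → prefix t b ≡ suc (prefix t a)
  prefix-between {t} i<t t≤j = trans (≡-sym (ℕₚ.+-identityʳ _)) (trans
    (subst₂ (λ p q → prefix t b + p ≡ prefix t a + q) (before-≥ t≤j) (before-< i<t) (prefix-eq t))
    (ℕₚ.+-comm _ 1))

  position : ∀ t → t ≤ i ⊎ j < t ⊎ (i < t × t ≤ j)
  position t with t ≤? i | t ≤? j
  ... | yes t≤i | _       = inj₁ t≤i
  ... | no _    | no t≰j  = inj₂ (inj₁ (ℕₚ.≰⇒> t≰j))
  ... | no t≰i  | yes t≤j = inj₂ (inj₂ (ℕₚ.≰⇒> t≰i , t≤j))

  prefix-≤ : ∀ t → prefix t a ≤ prefix t b
  prefix-≤ t with position t
  ... | inj₁ t≤i                 = ℕₚ.≤-reflexive (≡-sym (prefix-before t≤i))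
  ... | inj₂ (inj₁ j<t)          = ℕₚ.≤-reflexive (≡-sym (prefix-after j<t))
  ... | inj₂ (inj₂ (i<t , t≤j)) = ℕₚ.≤-trans (ℕₚ.n≤1+n _) (ℕₚ.≤-reflexive (≡-sym (prefix-between i<t t≤j)))

  antitone : Antitone a → Up a i → Down a j → Antitone b
  antitone anti up down s t s≤t with t ℕ.≟ i | s ℕ.≟ t | s ℕ.≟ j
  ... | _ | yes refl | _ = ℕₚ.≤-refl
  ... | yes refl | no s≢t | _ = subst (_≤ at b s) (≡-sym at-i)
        (ℕₚ.≤-trans (up s s<i) (at-≥′ (ℕₚ.<⇒≢ (ℕₚ.<-trans s<i i<j))))
    where s<i = ℕₚ.≤∧≢⇒< s≤t s≢t
  ... | no t≢i | no s≢t | yes refl = ℕₚ.≤-trans (at-≤ t≢i)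
        (ℕₚ.≤-pred (subst (at a t <_) (≡-sym at-j) (down t (ℕₚ.≤∧≢⇒< s≤t s≢t))))
  ... | no t≢i | no s≢t | no s≢j = ℕₚ.≤-trans (at-≤ t≢i) (ℕₚ.≤-trans (anti s t s≤t) (at-≥′ s≢j))

  -- The prefix sums of `a` and `b` agree up to `i` and after `j` and differ by 1 in between. So `c`
  -- is determined by its surplus over `a` at `i < t ≤ j`, which is 0 or 1 at each place; it has to
  -- be shown constant.
  module Between (anti : Antitone a) (c : Vec ℕ n) (c-anti : Antitone c)
    (a≤c : ∀ t → prefix t a ≤ prefix t c) (c≤b : ∀ t → prefix t c ≤ prefix t b) where

    low-everywhere : (∀ t → i < t → t ≤ j → prefix t c ≤ prefix t a) → c ≡ a
    low-everywhere low = prefix-ext λ t → ℕₚ.≤-antisym (lemma t) (a≤c t)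
      where
      lemma : ∀ t → prefix t c ≤ prefix t a
      lemma t with position t
      ... | inj₁ t≤i                 = subst (prefix t c ≤_) (prefix-before t≤i) (c≤b t)
      ... | inj₂ (inj₁ j<t)          = subst (prefix t c ≤_) (prefix-after j<t) (c≤b t)
      ... | inj₂ (inj₂ (i<t , t≤j)) = low t i<t t≤j

    high-everywhere : (∀ t → i < t → t ≤ j → prefix t a < prefix t c) → c ≡ b
    high-everywhere high = prefix-ext λ t → ℕₚ.≤-antisym (c≤b t) (lemma t)
      where
      lemma : ∀ t → prefix t b ≤ prefix t c
      lemma t with position t
      ... | inj₁ t≤i                 = subst (_≤ prefix t c) (≡-sym (prefix-before t≤i)) (a≤c t)
      ... | inj₂ (inj₁ j<t)          = subst (_≤ prefix t c) (≡-sym (prefix-after j<t)) (a≤c t)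
      ... | inj₂ (inj₂ (i<t , t≤j)) = subst (_≤ prefix t c) (≡-sym (prefix-between i<t t≤j)) (high t i<t t≤j)

    adjacent : j ≡ suc i → (c ≡ a) ⊎ (c ≡ b)
    adjacent refl with prefix (suc i) c ≤? prefix (suc i) a
    ... | yes le = inj₁ (low-everywhere λ t i<t t≤j → subst (λ k → prefix k c ≤ prefix k a) (ℕₚ.≤-antisym i<t t≤j) le)
    ... | no nle = inj₂ (high-everywhere λ t i<t t≤j → subst (λ k → prefix k a < prefix k c) (ℕₚ.≤-antisym i<t t≤j) (ℕₚ.≰⇒> nle))

    -- On a constant stretch of a the surplus of prefix c over prefix a is concave, vanishes at
    -- both ends and takes values in {0,1}, so it is identically 0 or identically 1 in between.
    plateau : at a i ≡ at a j → (c ≡ a) ⊎ (c ≡ b)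
    plateau ai≡aj with prefix (suc i) c ≤? prefix (suc i) a
    ... | yes le = inj₁ (low-everywhere λ t _ t≤j → low t t≤j)
      where
      -- No surplus just after `i` means that `c` does not exceed the plateau value at `i`, hence
      -- nowhere later, and a surplus cannot start.
      ci≤ai : at c i ≤ at a i
      ci≤ai = ℕₚ.+-cancelˡ-≤ (prefix i a) _ _ (ℕₚ.≤-trans (ℕₚ.+-monoˡ-≤ (at c i) (a≤c i))
        (subst₂ _≤_ (prefix-suc i c) (prefix-suc i a) le))
      low : ∀ t → t ≤ j → prefix t c ≤ prefix t a
      low zero    _   = z≤n
      low (suc t) t<j with suc t ≤? i
      ... | yes t<i = subst (prefix (suc t) c ≤_) (prefix-before t<i) (c≤b (suc t))
      ... | no t≮i = subst₂ _≤_ (≡-sym (prefix-suc t c)) (≡-sym (prefix-suc t a))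
            (ℕₚ.+-mono-≤ (low t (ℕₚ.<⇒≤ t<j)) (ℕₚ.≤-trans (c-anti i t i≤t) (ℕₚ.≤-trans ci≤ai
              (subst (_≤ at a t) (≡-sym ai≡aj) (anti t j (ℕₚ.<⇒≤ t<j))))))
        where i≤t = ℕₚ.≮⇒≥ t≮i
    ... | no nle = inj₂ (high-everywhere λ t i<t t≤j → ℕₚ.≰⇒> (not-low t i<t t≤j))
      where
      flat : ∀ {t} → i ≤ t → t ≤ j → at a t ≡ at a i
      flat {t} i≤t t≤j = ℕₚ.≤-antisym (anti i t i≤t) (subst (_≤ at a t) (≡-sym ai≡aj) (anti t j t≤j))
      -- If `c` is at least the plateau value at `t`, it is so from `i` on, and the initial surplus
      -- cannot have been lost by `t`. If it is smaller, it stays smaller, and the prefix sum of `c`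
      -- falls below that of `a` after `j`.
      not-low : ∀ t → i < t → t ≤ j → ¬ (prefix t c ≤ prefix t a)
      not-low t i<t t≤j le with at a i ≤? at c t
      ... | yes v≤ct = ℕₚ.<⇒≱ (high t i<t ℕₚ.≤-refl) le
        where
        high : ∀ s → i < s → s ≤ t → prefix s a < prefix s c
        high (suc s) i<1+s s<t with s ℕ.≟ i
        ... | yes refl = ℕₚ.≰⇒> nle
        ... | no s≢i = subst₂ _<_ (≡-sym (prefix-suc s a)) (≡-sym (prefix-suc s c))
              (ℕₚ.+-mono-<-≤ (high s i<s (ℕₚ.<⇒≤ s<t))
                (ℕₚ.≤-trans (ℕₚ.≤-reflexive (flat (ℕₚ.<⇒≤ i<s) (ℕₚ.≤-trans (ℕₚ.<⇒≤ s<t) t≤j)))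
                  (ℕₚ.≤-trans v≤ct (c-anti s t (ℕₚ.<⇒≤ s<t)))))
          where i<s = ℕₚ.≤∧≢⇒< (ℕₚ.≤-pred i<1+s) (s≢i ∘ ≡-sym)
      ... | no v≰ct = ℕₚ.<⇒≱ (fall (suc j) (s≤s t≤j) ℕₚ.≤-refl) (a≤c (suc j))
        where
        fall : ∀ s → t < s → s ≤ suc j → prefix s c < prefix s a
        fall (suc s) (s≤s t≤s) (s≤s s≤j) = subst₂ _<_ (≡-sym (prefix-suc s c)) (≡-sym (prefix-suc s a))
          (ℕₚ.+-mono-≤-< prefix≤ (subst (at c s <_) (≡-sym (flat (ℕₚ.≤-trans (ℕₚ.<⇒≤ i<t) t≤s) s≤j))
            (ℕₚ.≤-<-trans (c-anti t s t≤s) (ℕₚ.≰⇒> v≰ct))))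
          where
          prefix≤ : prefix s c ≤ prefix s a
          prefix≤ with s ℕ.≟ t
          ... | yes refl = le
          ... | no s≢t = ℕₚ.<⇒≤ (fall s (ℕₚ.≤∧≢⇒< t≤s (s≢t ∘ ≡-sym)) (ℕₚ.≤-trans s≤j (ℕₚ.n≤1+n j)))

transfer : ∀ {n} (a : Vec ℕ n) {i j} → i < j → 0 < at a j → ∃ λ b → Transfer i j a b
transfer {n} a {i} {j} i<j aj>0 = fromAt n h , eq
  where
  j<n = at-positive a aj>0
  h : ℕ → ℕ
  h t = (at a t + δ i t) ∸ δ j t
  room : ∀ t → δ j t ≤ at a t + δ i t
  room t with j ℕ.≟ t
  ... | yes refl = subst (_≤ at a j + δ i j) (≡-sym (δ-refl j)) (ℕₚ.≤-trans aj>0 (ℕₚ.m≤m+n _ _))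
  ... | no j≢t = subst (_≤ at a t + δ i t) (≡-sym (δ-≢ j≢t)) z≤n
  eq : ∀ t → at (fromAt n h) t + δ j t ≡ at a t + δ i t
  eq t with t ℕ.<? n
  ... | yes t<n = trans (cong (_+ δ j t) (at-fromAt h t<n)) (ℕₚ.m∸n+n≡m (room t))
  ... | no t≮n = cong₂ _+_ (trans (at-≥ (fromAt n h) n≤t) (≡-sym (at-≥ a n≤t)))
        (trans (δ-≢ (ℕₚ.<⇒≢ (ℕₚ.<-≤-trans j<n n≤t))) (≡-sym (δ-≢ (ℕₚ.<⇒≢ (ℕₚ.<-≤-trans (ℕₚ.<-trans i<j j<n) n≤t)))))
    where n≤t = ℕₚ.≮⇒≥ t≮n

-- The two kinds of covers in Brylawski's description of the dominance order: between neighbouring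
-- positions, or across a stretch of equal entries.
transfer-covers : ∀ {s n} (a : Vec ℕ n) {i j} → InP s n a → i < j → Up a i → Down a j →
  (j ≡ suc i ⊎ at a i ≡ at a j) → ∃ λ b → Transfer i j a b × Covers s n a b
transfer-covers {s} {n} a {i} {j} (ni , sum-a) i<j up down kind with transfer a i<j aj>0
  where
  aj>0 : 0 < at a j
  aj>0 = ℕₚ.≤-<-trans z≤n (down (suc j) (ℕₚ.n<1+n j))
... | b , T = b , T , (antitone⇒nonincreasing b (antitone anti up down) , trans sum-b sum-a)
    , (sum-b , prefix-≤)
    , (λ { refl → ℕₚ.1+n≢n (≡-sym at-i) })
    , between
  where
  open Transferred {a = a} {b} i<j T
  anti = nonincreasing⇒antitone a ni
  j<n = at-positive a (ℕₚ.≤-<-trans z≤n (down (suc j) (ℕₚ.n<1+n j)))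
  sum-b : Vec.sum b ≡ Vec.sum a
  sum-b = trans (sum-prefix b) (trans (prefix-after j<n) (≡-sym (sum-prefix a)))
  between : ∀ c → InP s n c → c ⊵ a → b ⊵ c → (c ≡ a) ⊎ (c ≡ b)
  between c (c-ni , _) (_ , a≤c) (_ , c≤b) = choose kind
    where
    open Between anti c (nonincreasing⇒antitone c c-ni) a≤c c≤b
    choose : (j ≡ suc i ⊎ at a i ≡ at a j) → (c ≡ a) ⊎ (c ≡ b)
    choose (inj₁ e) = adjacent e
    choose (inj₂ e) = plateau e

first-of-plateau : ∀ {n} (a : Vec ℕ n) → Antitone a → ∀ r →
  ∃ λ i → i ≤ r × at a i ≡ at a r × Up a i
first-of-plateau a anti zero = 0 , z≤n , refl , λ _ ()
first-of-plateau a anti (suc r) with at a r ≤? at a (suc r)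
... | no nle = suc r , ℕₚ.≤-refl , refl ,
      λ l l≤r → ℕₚ.<-≤-trans (ℕₚ.≰⇒> nle) (anti l r (ℕₚ.≤-pred l≤r))
... | yes le with first-of-plateau a anti r
...   | i , i≤r , eq , up = i , ℕₚ.≤-trans i≤r (ℕₚ.n≤1+n r) ,
        trans eq (ℕₚ.≤-antisym le (anti r (suc r) (ℕₚ.n≤1+n r))) , up

-- Positivity excludes the endless run of zeros past the end; it bounds the search by `n`.
last-of-plateau : ∀ {n} (a : Vec ℕ n) → Antitone a → ∀ y → 0 < at a y →
  ∃ λ j → y ≤ j × at a j ≡ at a y × Down a j
last-of-plateau {n} a anti y ay>0 = search n y (ℕₚ.m≤n+m n y) ay>0
  where
  search : ∀ k y → n ≤ y + k → 0 < at a y → ∃ λ j → y ≤ j × at a j ≡ at a y × Down a j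
  search zero y n≤y ay>0 =
    contradiction (at-positive a ay>0) (ℕₚ.≤⇒≯ (subst (n ≤_) (ℕₚ.+-identityʳ y) n≤y))
  search (suc k) y n≤ ay>0 with at a y ≤? at a (suc y)
  ... | no nle = y , ℕₚ.≤-refl , refl , λ l y<l → ℕₚ.≤-<-trans (anti (suc y) l y<l) (ℕₚ.≰⇒> nle)
  ... | yes le with search k (suc y) (subst (n ≤_) (ℕₚ.+-suc y k) n≤) (ℕₚ.<-≤-trans ay>0 le)
  ...   | j , y<j , eq , down = j , ℕₚ.<⇒≤ y<j ,
          trans eq (ℕₚ.≤-antisym (anti y (suc y) (ℕₚ.n≤1+n y)) le) , down

-- Short chains of covers

Climb : ∀ s n → ℕ → ℕ → ℕ → Vec ℕ n → Set
Climb s n k i j a = ∃ λ d → Transfer i j a d × InP s n d × ∃ λ m → m ≤ k × Steps s n m a d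

climb-one : ∀ {s n k i j} {a : Vec ℕ n} → (∃ λ b → Transfer i j a b × Covers s n a b) → Climb s n (suc k) i j a
climb-one (b , T , cov) = b , T , proj₁ cov , 1 , s≤s z≤n , b , cov , refl

-- In general the unit travels from `j` to the start r + 1 of its plateau and then over the drop to
-- `r`. Without a drop, or with `j` equal to r + 1, a single cover does both.
climb-up : ∀ {s n} (a : Vec ℕ n) {r j} → InP s n a → Up a r → r < j → Down a j →
  at a j ≡ at a (suc r) → Climb s n 2 r j a
climb-up {s} {n} a {r} {j} a∈P up r<j down eq with at a r ≤? at a (suc r) | j ℕ.≟ suc r
... | yes le | _ = climb-one {i = r} {j} (transfer-covers a a∈P r<j up down
        (inj₂ (trans (ℕₚ.≤-antisym le (nonincreasing⇒antitone a (proj₁ a∈P) r (suc r) (ℕₚ.n≤1+n r))) (≡-sym eq))))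
... | no _ | yes refl = climb-one {i = r} {j} (transfer-covers a a∈P r<j up down (inj₁ refl))
... | no nle | no j≢1+r with transfer-covers a a∈P 1+r<j up′ down (inj₂ (≡-sym eq))
  where
  1+r<j = ℕₚ.≤∧≢⇒< r<j (j≢1+r ∘ ≡-sym)
  up′ : Up a (suc r)
  up′ l l≤r = ℕₚ.<-≤-trans (ℕₚ.≰⇒> nle) (nonincreasing⇒antitone a (proj₁ a∈P) l r (ℕₚ.≤-pred l≤r))
...   | b , T , cov = second (transfer-covers b (proj₁ cov) (ℕₚ.n<1+n r) up″ down″ (inj₁ refl))
  where
  1+r<j = ℕₚ.≤∧≢⇒< r<j (j≢1+r ∘ ≡-sym)
  open Transferred {a = a} {b} 1+r<j T
  anti = nonincreasing⇒antitone a (proj₁ a∈P)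
  up″ : Up b r
  up″ l l<r = subst₂ _<_
    (≡-sym (at-≡ (ℕₚ.<⇒≢ (ℕₚ.n<1+n r)) (ℕₚ.<⇒≢ r<j)))
    (≡-sym (at-≡ (ℕₚ.<⇒≢ (ℕₚ.<-trans l<r (ℕₚ.n<1+n r))) (ℕₚ.<⇒≢ (ℕₚ.<-trans l<r r<j)))) (up l l<r)
  down″ : Down b (suc r)
  down″ l 1+r<l = subst (at b l <_) (≡-sym at-i)
    (s≤s (ℕₚ.≤-trans (at-≤ (ℕₚ.<⇒≢ 1+r<l ∘ ≡-sym)) (anti (suc r) l (ℕₚ.<⇒≤ 1+r<l))))
  second : (∃ λ c → Transfer r (suc r) b c × Covers s n b c) → Climb s n 2 r j a
  second (c , T′ , cov′) = c , compose , proj₁ cov′ , 2 , ℕₚ.≤-refl , b , cov , c , cov′ , refl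
    where
    compose : Transfer r j a c
    compose t = ℕₚ.+-cancelʳ-≡ (δ (suc r) t) _ _ (begin
      at c t + δ j t + δ (suc r) t ≡⟨ swapʳ (at c t) (δ j t) (δ (suc r) t) ⟩
      at c t + δ (suc r) t + δ j t ≡⟨ cong (_+ δ j t) (T′ t) ⟩
      at b t + δ r t + δ j t       ≡⟨ swapʳ (at b t) (δ r t) (δ j t) ⟩
      at b t + δ j t + δ r t       ≡⟨ cong (_+ δ r t) (T t) ⟩
      at a t + δ (suc r) t + δ r t ≡⟨ swapʳ (at a t) (δ (suc r) t) (δ r t) ⟩
      at a t + δ r t + δ (suc r) t ∎)
      where
      open ≡-Reasoning
      swapʳ : ∀ p q r → p + q + r ≡ p + r + q
      swapʳ = solve 3 (λ p q r → p :+ q :+ r := p :+ r :+ q) refl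

-- With a drop after `r`, the upper plateau is treated before the rest: a unit goes from `r` to `i`,
-- which puts entry `r` strictly below all earlier ones, and `climb-up` then refills it from `j`.
-- Without a drop, `i` to `j` is one plateau.
climb : ∀ {s n} (a : Vec ℕ n) {i r j} → InP s n a → Up a i → i ≤ r → at a i ≡ at a r →
  r < j → Down a j → at a j ≡ at a (suc r) → Climb s n 3 i j a
climb {s} {n} a {i} {r} {j} a∈P up i≤r ai≡ar r<j down eq with i ℕ.≟ r | at a r ≤? at a (suc r)
... | yes refl | _ with climb-up a a∈P up r<j down eq
...   | d , T , d∈P , m , m≤2 , steps = d , T , d∈P , m , ℕₚ.≤-trans m≤2 (ℕₚ.n≤1+n 2) , steps
climb {s} {n} a {i} {r} {j} a∈P up i≤r ai≡ar r<j down eq | no i≢r | yes le =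
  climb-one {i = i} {j} (transfer-covers a a∈P (ℕₚ.≤-<-trans i≤r r<j) up down (inj₂ (trans ai≡ar
    (trans (ℕₚ.≤-antisym le (nonincreasing⇒antitone a (proj₁ a∈P) r (suc r) (ℕₚ.n≤1+n r))) (≡-sym eq)))))
climb {s} {n} a {i} {r} {j} a∈P up i≤r ai≡ar r<j down eq | no i≢r | no nle
  with transfer-covers a a∈P (ℕₚ.≤∧≢⇒< i≤r i≢r) up
         (λ l r<l → ℕₚ.≤-<-trans (nonincreasing⇒antitone a (proj₁ a∈P) (suc r) l r<l) (ℕₚ.≰⇒> nle)) (inj₂ ai≡ar)
... | b , T , cov = finish (climb-up b (proj₁ cov) up′ r<j down′ eq′)
  where
  i<r = ℕₚ.≤∧≢⇒< i≤r i≢r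
  open Transferred {a = a} {b} i<r T
  anti = nonincreasing⇒antitone a (proj₁ a∈P)
  up′ : Up b r
  up′ l l<r = ℕₚ.<-≤-trans (ℕₚ.≤-reflexive at-j)
    (ℕₚ.≤-trans (anti l r (ℕₚ.<⇒≤ l<r)) (at-≥′ (ℕₚ.<⇒≢ l<r)))
  above : ∀ {l} → r < l → at b l ≡ at a l
  above r<l = at-≡ (ℕₚ.<⇒≢ (ℕₚ.<-trans i<r r<l) ∘ ≡-sym) (ℕₚ.<⇒≢ r<l ∘ ≡-sym)
  down′ : Down b j
  down′ l j<l = subst₂ _<_ (≡-sym (above (ℕₚ.<-trans r<j j<l))) (≡-sym (above r<j)) (down l j<l)
  eq′ : at b j ≡ at b (suc r)
  eq′ = trans (above r<j) (trans eq (≡-sym (above (ℕₚ.n<1+n r))))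
  finish : Climb s n 2 r j b → Climb s n 3 i j a
  finish (d , T′ , d∈P , m , m≤2 , steps) =
    d , (λ t → trans (T′ t) (T t)) , d∈P , suc m , s≤s m≤2 , b , cov , steps

-- Extreme pairs and the conclusion

forced-edge⇒tight : ∀ {n} {f : Fin n → ℕ} → (∀ i j → toℕ i ≤ toℕ j → f j ≤ f i) →
  (G : Graph n) → HasDegrees G f → ∀ {i j} → i ≢ j → Forced true f i j → Tight f
forced-edge⇒tight {suc zero} _ _ _ {zero} {zero} i≢j _ = contradiction refl i≢j
forced-edge⇒tight {suc (suc n)} {f} sorted G degs i≢j forced =
  forced-top-edge⇒tight sorted G degs {zero} {suc zero} (λ ()) first-two second
    (to-extremes {F = Forced true f} {R = λ u x → f u ≤ f x}
      (λ F G degs → adj-sym G (F G degs)) (λ _ x≢v F fu≤fx → forced-edge-shift F fu≤fx x≢v)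
      (λ u → sorted zero u z≤n) second (λ ()) i≢j forced)
  where
  second : ∀ i → i ≢ zero → f i ≤ f (suc zero)
  second zero    i≢0 = contradiction refl i≢0
  second (suc i) _   = sorted (suc zero) (suc i) (s≤s z≤n)
  first-two : ∀ i j → toℕ i ≤ toℕ j → twoδ zero (suc zero) j ≤ twoδ zero (suc zero) i
  first-two zero          zero          _ = ℕₚ.≤-refl
  first-two zero          (suc zero)    _ = ℕₚ.≤-refl
  first-two zero          (suc (suc _)) _ = z≤n
  first-two (suc zero)    (suc zero)    _ = ℕₚ.≤-refl
  first-two (suc zero)    (suc (suc _)) _ = z≤n
  first-two (suc (suc _)) (suc zero)    (s≤s ())
  first-two (suc (suc _)) (suc (suc _)) _ = z≤n

-- The decomposition has A = {q} and empty B; `p` witnesses that the rest is nonempty.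
isolated⇒canDec : ∀ {n} (G : Graph n) {p q} → p ≢ q → deg G q ≡ 0 → IsCanDecGraph G
isolated⇒canDec {n} G {p} {q} p≢q dq =
  ρ , (q , inj₁ ρq) , (p , ρ-other p≢q)
    , (λ u v ρu ρv → no-edge u v (A⇒q u ρu))
    , (λ u v ρu _ _ → contradiction ρu (not-B u))
    , (λ u v ρu _ → contradiction ρu (not-B u))
    , (λ u v ρu _ → no-edge u v (A⇒q u ρu))
  where
  ρ : Fin n → Role
  ρ u = if does (u ≟ q) then roleA else roleH
  ρq : ρ q ≡ roleA
  ρq with q ≟ q
  ... | yes _ = refl
  ... | no q≢q = contradiction refl q≢q
  ρ-other : ∀ {u} → u ≢ q → ρ u ≡ roleH
  ρ-other {u} u≢q with u ≟ q
  ... | yes u≡q = contradiction u≡q u≢q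
  ... | no _ = refl
  A⇒q : ∀ u → ρ u ≡ roleA → u ≡ q
  A⇒q u eq with u ≟ q
  ... | yes u≡q = u≡q
  A⇒q u () | no _
  not-B : ∀ u → ρ u ≢ roleB
  not-B u eq with u ≟ q
  not-B u () | yes _
  not-B u () | no _
  no-edge : ∀ u v → u ≡ q → adj G u v ≡ false
  no-edge u v refl = ¬-not λ uv → 𝟙≢0 uv (sum-mono-≡ {f = λ _ → 0} (λ _ → z≤n)
    (subst₂ _≤_ (≡-sym dq) (≡-sym (sum-replicate-zero n)) z≤n) v)
    where
    𝟙≢0 : ∀ {b} → b ≡ true → 0 ≢ 𝟙 b
    𝟙≢0 refl ()

forced-nonedge⇒canDec⊎tight : ∀ {n} {f : Fin n → ℕ} → (∀ i j → toℕ i ≤ toℕ j → f j ≤ f i) →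
  (G : Graph n) → HasDegrees G f → ∀ {i j} → i ≢ j → Forced false f i j → IsCanDecGraph G ⊎ Tight f
forced-nonedge⇒canDec⊎tight {suc zero} _ _ _ {zero} {zero} i≢j _ = contradiction refl i≢j
forced-nonedge⇒canDec⊎tight {suc (suc n)} {f} sorted G degs i≢j forced with f q in fq
  where
  q = fromℕ (suc n)
... | zero = inj₁ (isolated⇒canDec G {zero} {fromℕ (suc n)} (λ ()) (trans (degs _) fq))
... | suc k = inj₂ (forced-bottom-nonedge⇒tight sorted G degs (ℕₚ.<⇒≢ p<q ∘ cong toℕ) before-p p<q
      (subst (1 ≤_) (≡-sym fq) (s≤s z≤n))
      (Forced-swap (to-extremes {F = Forced false f} {R = λ u x → f x ≤ f u}
        (λ F G degs → adj-sym G (F G degs)) (λ u≢v _ F fx≤fu → forced-nonedge-shift u≢v F fx≤fu)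
        (λ u → sorted u q (ℕₚ.≤-trans (ℕₚ.≤-pred (toℕ<n u)) (ℕₚ.≤-reflexive (≡-sym toℕ-q))))
        (λ u u≢q → sorted u p (ℕₚ.≤-trans (≢q⇒≤n u u≢q) (ℕₚ.≤-reflexive (≡-sym toℕ-p))))
        (ℕₚ.<⇒≢ p<q ∘ cong toℕ ∘ ≡-sym) i≢j forced)))
  where
  q p : Fin (suc (suc n))
  q = fromℕ (suc n)
  p = inject₁ (fromℕ n)
  toℕ-q : toℕ q ≡ suc n
  toℕ-q = toℕ-fromℕ (suc n)
  toℕ-p : toℕ p ≡ n
  toℕ-p = trans (toℕ-inject₁ (fromℕ n)) (toℕ-fromℕ n)
  p<q : toℕ p < toℕ q
  p<q = subst₂ _<_ (≡-sym toℕ-p) (≡-sym toℕ-q) (ℕₚ.n<1+n n)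
  ≢q⇒≤n : ∀ u → u ≢ q → toℕ u ≤ n
  ≢q⇒≤n u u≢q = ℕₚ.≤-pred (ℕₚ.≤∧≢⇒< (ℕₚ.≤-pred (toℕ<n u))
    λ e → u≢q (toℕ-injective (trans e (≡-sym toℕ-q))))
  before-p : ∀ u → u ≢ p → u ≢ q → toℕ u < toℕ p
  before-p u u≢p u≢q = ℕₚ.≤∧≢⇒< (subst (toℕ u ≤_) (≡-sym toℕ-p) (≢q⇒≤n u u≢q)) (u≢p ∘ toℕ-injective)
  Forced-swap : Forced false f q p → Forced false f p q
  Forced-swap F G degs = adj-sym G (F G degs)

climb-to-canDec : ∀ {s n} (e : Vec ℕ n) → InP s n e → Liftable (lookup e) →
  Σ (Vec ℕ n) λ d → InP s n d × CanDecSeq d × Σ ℕ λ k → k ≤ 3 × Steps s n k e d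
climb-to-canDec {s} {n} e e∈P (r , y , r<y , fy>0 , lift)
  with first-of-plateau e anti (toℕ r) | last-of-plateau e anti (suc (toℕ r)) next>0
  where
  anti = nonincreasing⇒antitone e (proj₁ e∈P)
  -- The entry at `y`, at or after position r + 1, is positive, so the plateau of r + 1 ends inside
  -- the sequence.
  next>0 : 0 < at e (suc (toℕ r))
  next>0 = ℕₚ.<-≤-trans (subst (0 <_) (≡-sym (at-toℕ e y)) fy>0) (anti _ _ r<y)
... | i , i≤r , ei≡er , up | j , r<j , ej≡ , down
  with climb e e∈P up i≤r ei≡er r<j down ej≡
     | lift (fromℕ< i<n) (fromℕ< j<n)
         (subst (_≤ toℕ r) (≡-sym (toℕ-fromℕ< i<n)) i≤r)
         (ℕₚ.≤-reflexive (trans (≡-sym (at-fromℕ< i<n)) (trans ei≡er (at-toℕ e r))))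
         (subst (toℕ r <_) (≡-sym (toℕ-fromℕ< j<n)) r<j)
         (subst₂ _≤_ (at-toℕ e y) (trans (≡-sym ej≡) (at-fromℕ< j<n)) (anti _ _ r<y))
  where
  anti = nonincreasing⇒antitone e (proj₁ e∈P)
  i<n = ℕₚ.≤-<-trans i≤r (toℕ<n r)
  j<n = at-positive e (ℕₚ.≤-<-trans z≤n (down (suc j) (ℕₚ.n<1+n j)))
  at-fromℕ< : ∀ {k} (k<n : k < n) → at e k ≡ lookup e (fromℕ< k<n)
  at-fromℕ< k<n = trans (≡-sym (cong (at e) (toℕ-fromℕ< k<n))) (at-toℕ e _)
... | d , T , d∈P , k , k≤3 , steps | G , canDec , degs =
  d , d∈P , (G , realizes , canDec) , k , k≤3 , steps
  where
  i<n = ℕₚ.≤-<-trans i≤r (toℕ<n r)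
  j<n = at-positive e (ℕₚ.≤-<-trans z≤n (down (suc j) (ℕₚ.n<1+n j)))
  realizes : Realizes G d
  -- The degrees of `G` and the entries of `d` solve the same additive equation for e + 1_i - 1_j;
  -- cancelling 1_j identifies them.
  realizes l = trans (degree≡deg G l) (ℕₚ.+-cancelʳ-≡ (δF (fromℕ< j<n) l) _ _ (trans (degs l) (≡-sym (begin
    lookup d l + δF (fromℕ< j<n) l ≡⟨ cong₂ _+_ (≡-sym (at-toℕ d l)) (cong (λ k → δ k (toℕ l)) (toℕ-fromℕ< j<n)) ⟩
    at d (toℕ l) + δ j (toℕ l)     ≡⟨ T (toℕ l) ⟩
    at e (toℕ l) + δ i (toℕ l)     ≡⟨ cong₂ _+_ (at-toℕ e l) (cong (λ k → δ k (toℕ l)) (≡-sym (toℕ-fromℕ< i<n))) ⟩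
    lookup e l + δF (fromℕ< i<n) l ∎))))
    where open ≡-Reasoning

theorem4p5 : (s n : ℕ) (e : Vec ℕ n) → InP s n e → Graphic e → HasForcedPair e →
    Σ (Vec ℕ n) λ d → InP s n d × (SplitSeq d ⊎ CanDecSeq d) ×
    Σ ℕ λ k → k ≤ 3 × Steps s n k e d
theorem4p5 s n e e∈P (G , realizes) (i , j , i≢j , forced) = conclude (from-forced forced)
  where
  degs : HasDegrees G (lookup e)
  degs l = trans (≡-sym (degree≡deg G l)) (realizes l)
  forced′ : ∀ {b} → (∀ H → Realizes H e → adj H i j ≡ b) → Forced b (lookup e) i j
  forced′ F H degsH = F H λ l → trans (degree≡deg H l) (degsH l)
  from-forced : _ → (IsSplitGraph G ⊎ IsCanDecGraph G) ⊎ Liftable (lookup e)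
  from-forced (inj₁ F) = tight⇒structure (proj₁ e∈P) G degs
    (forced-edge⇒tight (proj₁ e∈P) G degs i≢j (forced′ F))
  from-forced (inj₂ F) with forced-nonedge⇒canDec⊎tight (proj₁ e∈P) G degs i≢j (forced′ F)
  ... | inj₁ canDec = inj₁ (inj₂ canDec)
  ... | inj₂ tight  = tight⇒structure (proj₁ e∈P) G degs tight
  conclude : (IsSplitGraph G ⊎ IsCanDecGraph G) ⊎ Liftable (lookup e) → _
  conclude (inj₁ (inj₁ split))  = e , e∈P , inj₁ (G , realizes , split) , 0 , z≤n , refl
  conclude (inj₁ (inj₂ canDec)) = e , e∈P , inj₂ (G , realizes , canDec) , 0 , z≤n , refl
  conclude (inj₂ liftable) with climb-to-canDec e e∈P liftable
  ... | d , d∈P , canDec , steps = d , d∈P , inj₂ canDec , steps
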